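{- Let $\sigma$ be a finite relational signature and let $\mathbb G$ be a $coPLA^+(\sigma)$-network. If $\varphi(\bar x)\in CPL(\sigma)$ is safe with respect to $\mathbb G$, then $\varphi(\bar x)$ is almost surely equivalent, with respect to the sequence of probability distributions induced by $\mathbb G$, to a quantifier-free formula.
   Context: **Notation.** $[n]=\{1,\dots,n\}$; for a finite sequence $\bar a$, $|\bar a|$ is its length and $\mathrm{rng}(\bar a)$ the set of its entries. $[0,1]^{<\omega}$ is the set of finite nonempty sequences of reals in $[0,1]$. A finite relational signature is a finite set of relation symbols. $\mathbf W_n$ is the set of all $\sigma$-structures with domain $[n]$. A structure $\mathcal A$ has domain $A$; $\mathcal A\restriction\sigma'$ is the reduct to $\sigma'\subseteq\sigma$. **Atomic types.** An atomic $\sigma$-type $p(\bar x)$ is a consistent set of first-order literals over $\sigma$ (formulas $x=y$, $R(x_1,\dots,x_r)$ with $R\in\sigma$, and their negations) with variables among $\bar x$, identified with the conjunction of its members; it is complete if for every atomic formula over $\sigma$ with variables among $\bar x$ it contains that formula or its negation. An atomic $\emptyset$-type contains only equalities and inequalities. **Aggregation functions.** A function $F:([0,1]^{<\omega})^k\to[0,1]$ is an aggregation function if its value is unchanged when the entries within each argument sequence are reordered. A sequence $\bar r_n\in[0,1]^{<\omega}$ ($n\in\mathbb N$), with $i$th entry $r_{n,i}$, is convergence testing for parameters $c_1,\dots,c_k\in[0,1]$, $\alpha_1,\dots,\alpha_k\in[0,1]$ if (1) $|\bar r_n|<|\bar r_{n+1}|$ for all $n$, and (2) for every disjoint family of intervals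 $I_1,\dots,I_k\subseteq[0,1]$, open in $[0,1]$, with $c_i\in I_i$, there is $N$ with $\mathrm{rng}(\bar r_n)\subseteq\bigcup_j I_j$ for all $n\ge N$, and $\lim_{n\to\infty}|\{i\le|\bar r_n| : r_{n,i}\in I_j\}|/|\bar r_n|=\alpha_j$ for each $j$. A sequence of $m$-tuples $(\bar r_{1,n},\dots,\bar r_{m,n})$ is convergence testing for $c_{i,j},\alpha_{i,j}$ ($1\le i\le m$, $1\le j\le k_i$) if for each $i$ the sequence $(\bar r_{i,n})_n$ is convergence testing for $c_{i,1},\dots,c_{i,k_i}$ and $\alpha_{i,1},\dots,\alpha_{i,k_i}$. An aggregation function $F:([0,1]^{<\omega})^m\to[0,1]$ is strongly admissible (= continuous) if (1) for all $n_1,\dots,n_m\in\mathbb N^+$, $F$ is continuous on $[0,1]^{n_1}\times\dots\times[0,1]^{n_m}$, and (2) for any two sequences of $m$-tuples $(\bar r_{1,n},\dots,\bar r_{m,n})$ and $(\bar\rho_{1,n},\dots,\bar\rho_{m,n})$ that are convergence testing with the same parameters $c_{i,j},\alpha_{i,j}\in[0,1]$, $\lim_{n\to\infty}|F(\bar r_{1,n},\dots,\bar r_{m,n})-F(\bar\rho_{1,n},\dots,\bar\rho_{m,n})|=0$. **The logic $coPLA^+(\sigma)$.** Formulas $\varphi(\bar x)$ (free variables among the distinct variables $\bar x$) and their values $\mathcal A(\varphi(\bar a))\in[0,1]$, for finite $\sigma$-structures $\mathcal A$ and $\bar a\in A^{|\bar x|}$, are defined inductively: (1) each $c\in[0,1]$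 is a formula without free variables, with value $c$; (2),(3) $x=y$ and $R(x_1,\dots,x_r)$, $R\in\sigma$, are formulas with value 1 if true and 0 otherwise; (4) if $\mathsf C:[0,1]^n\to[0,1]$ is continuous and $\varphi_1,\dots,\varphi_n$ are formulas, then $\mathsf C(\varphi_1,\dots,\varphi_n)$ is a formula, with value $\mathsf C$ applied to the values of the $\varphi_i$; (5) if $\varphi_1(\bar x,\bar y),\dots,\varphi_k(\bar x,\bar y)$ are formulas ($\bar x,\bar y$ disjoint sequences of distinct variables), $p^=(\bar x,\bar y)$ is a (possibly empty) atomic $\emptyset$-type and $F:([0,1]^{<\omega})^k\to[0,1]$ is a strongly admissible aggregation function, then $F(\varphi_1,\dots,\varphi_k:\bar y:p^=(\bar x,\bar y))$ is a formula in which $\bar y$ is bound; its value at $\bar a$ is $F(\bar r_1,\dots,\bar r_k)$ with $\bar r_i=(\mathcal A(\varphi_i(\bar a,\bar b)):\bar b\in A^{|\bar y|},\ p^=(\bar a,\bar b)\text{ holds})$ if some such $\bar b$ exists, and $0$ otherwise. **Networks.** A $coPLA^+(\sigma)$-network $\mathbb G$ consists of a directed acyclic graph with vertex set $\sigma$ and, for each $R\in\sigma$ of arity $k_R$, a formula $\theta_R(\bar x)\in coPLA^+(\mathrm{par}(R))$, $|\bar x|=k_R$, where $\mathrm{par}(R)$ is the set of parents of $R$. Let $\mathrm{mp}(R)$ be the maximal length of a directed path ending in $R$, $\rho=\max_R\mathrm{mp}(R)$, $\sigma_r=\{R:\mathrm{mp}(R)\le r\}$, $\sigma_{ -1}=\emptyset$.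 The induced distribution on $\mathbf W_n$ is $\mathbb P_n=\mathbb P_n^{\rho}$, where $\mathbb P_n^{ -1}$ is the unique distribution on the one-element set of $\emptyset$-structures with domain $[n]$, and for a $\sigma_r$-structure $\mathcal A$ with domain $[n]$ and $\mathcal A'=\mathcal A\restriction\sigma_{r-1}$, $$\mathbb P_n^r(\mathcal A)=\mathbb P_n^{r-1}(\mathcal A')\prod_{R\in\sigma_r\setminus\sigma_{r-1}}\ \prod_{\bar a\in R^{\mathcal A}}\mathcal A'(\theta_R(\bar a))\prod_{\bar a\in[n]^{k_R}\setminus R^{\mathcal A}}(1-\mathcal A'(\theta_R(\bar a))).$$ (If $\sigma=\emptyset$, there is a unique network and $\mathbb P_n$ is the unique distribution.) **Conditional probability logic.** $CPL(\sigma)$ is the (two-valued) logic built from atomic first-order formulas over $\sigma$ (with equality) using $\neg,\wedge,\vee,\to,\leftrightarrow$, $\exists x$ ($\forall x$ abbreviates $\neg\exists x\neg$), and: if $r\ge0$ is real, $\varphi,\psi,\theta,\tau\in CPL(\sigma)$ and $\bar y$ is a sequence of distinct variables, then $(r+\|\varphi\,|\,\psi\|_{\bar y}\ge\|\theta\,|\,\tau\|_{\bar y})$ and $(\|\varphi\,|\,\psi\|_{\bar y}\ge\|\theta\,|\,\tau\|_{\bar y}+r)$ are formulas, in which $\bar y$ is bound. For a formula $\varphi(\bar x,\bar y)$, a finite $\sigma$-structure $\mathcal A$ and $\bar a\in A^{|\bar x|}$ let $\varphi(\bar a,\mathcal A)=\{\bar b\in A^{|\bar y|}:\mathcal A\models\varphi(\bar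 a,\bar b)\}$. Then $\mathcal A\models(r+\|\varphi(\bar a,\bar y)|\psi(\bar a,\bar y)\|_{\bar y}\ge\|\theta(\bar a,\bar y)|\tau(\bar a,\bar y)\|_{\bar y})$ iff $\psi(\bar a,\mathcal A)\ne\emptyset$, $\tau(\bar a,\mathcal A)\neq\emptyset$ and $r+\frac{|\varphi(\bar a,\mathcal A)\cap\psi(\bar a,\mathcal A)|}{|\psi(\bar a,\mathcal A)|}\ge\frac{|\theta(\bar a,\mathcal A)\cap\tau(\bar a,\mathcal A)|}{|\tau(\bar a,\mathcal A)|}$; the other form is interpreted analogously. The other constructions are interpreted as in first-order logic. A formula is quantifier-free if it is built from atomic formulas (and $\top,\bot$) using only $\neg,\wedge,\vee,\to,\leftrightarrow$. **Safe formulas.** Let $(\mathbb P_n)$ be induced by $\mathbb G$. Suppose $\psi(\bar x,\bar y),\theta(\bar x,\bar y)\in CPL(\sigma)$ and $q(\bar x)$ is a complete atomic $\sigma$-type such that $\forall\bar x,\bar y(\theta(\bar x,\bar y)\to q(\bar x))$ is true in every finite $\sigma$-structure. The saturation number of $\|\psi(\bar x,\bar y)|\theta(\bar x,\bar y)\|_{\bar y}$ exists and is $\alpha\in[0,1]$ if for every $\varepsilon>0$, $$\lim_{n\to\infty}\mathbb P_n\Big(\Big\{\mathcal A\in\mathbf W_n:\text{there is }\bar a\in[n]^{|\bar x|}\text{ such that }\mathcal A\models q(\bar a)\text{ and }\Big|\alpha-\frac{|\psi(\bar a,\mathcal A)\cap\theta(\bar a,\mathcal A)|}{|\theta(\bar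 a,\mathcal A)|}\Big|>\varepsilon\Big\}\Big)=0.$$ A formula $\varphi\in CPL(\sigma)$ is safe with respect to $\mathbb G$ if (1) it contains neither $\forall$ nor $\exists$, and (2) for every subformula of $\varphi$ of the form $(\|\psi_1(\bar y,\bar z)|\theta_1(\bar y,\bar z)\|_{\bar z}\ge\|\psi_2(\bar y,\bar z)|\theta_2(\bar y,\bar z)\|_{\bar z}+r)$ or $(r+\|\psi_1(\bar y,\bar z)|\theta_1(\bar y,\bar z)\|_{\bar z}\ge\|\psi_2(\bar y,\bar z)|\theta_2(\bar y,\bar z)\|_{\bar z})$ and every complete atomic $\sigma$-type $q(\bar y)$ such that $\exists\bar y,\bar z,\bar z'(\theta_1(\bar y,\bar z)\wedge\theta_2(\bar y,\bar z')\wedge q(\bar y))$ has a finite model, the saturation number of $\|\psi_i(\bar y,\bar z)|\theta_i(\bar y,\bar z)\wedge q(\bar y)\|_{\bar z}$ exists for $i=1,2$, and if it is denoted by $\alpha_i$, then $r\neq|\alpha_1-\alpha_2|$. **Almost sure equivalence.** $\varphi(\bar x)$ and $\psi(\bar x)$ are almost surely equivalent with respect to $(\mathbb P_n)$ if $\lim_{n\to\infty}\mathbb P_n(\{\mathcal A\in\mathbf W_n:\text{for all }\bar a\in[n]^{|\bar x|},\ \mathcal A\models\varphi(\bar a)\Leftrightarrow\mathcal A\models\psi(\bar a)\})=1$.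
   Formalization: In the definition of saturation number, a tuple a satisfying q for which θ(a,A) is empty (so the fraction is undefined) is counted as deviating from α; if such tuples were ignored, the claim would be false. -}

module Defs where

open import Level using (0ℓ)
open import Algebra.Bundles using (CommutativeRing)
open import Axiom.ExcludedMiddle using (ExcludedMiddle)
open import Data.Bool.Base using (Bool; true; false; if_then_else_; not; T)
open import Data.Fin.Base using (Fin; zero; suc; _↑ˡ_)
open import Data.Fin.Properties using (_≟_)
open import Data.Fin.Subset using (Subset; ∣_∣; inside; outside) renaming (_∈_ to _∈ˢ_)
open import Data.List.Base as List using (List; []; _∷_; allFin; filter; upTo; cartesianProductWith)
open import Data.List.Membership.Propositional using (_∈_)
open import Data.List.NonEmpty.Base as List⁺ using (List⁺; _∷_; toList)
open import Data.List.Relation.Binary.Pointwise.Base using (Pointwise)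
open import Data.List.Relation.Unary.All using (All)
import Data.List.Relation.Binary.Permutation.Setoid as Permutation
open import Data.Nat.Base as ℕ using (ℕ; zero; suc)
import Data.Nat.Properties as ℕ
open import Data.Product.Base using (_×_; _,_; proj₁; proj₂; Σ; ∃; ∃₂)
open import Data.Sum.Base using (_⊎_; [_,_]′)
import Data.Unit.Base as Unit
import Data.Empty as Empty
open import Data.Vec.Base as Vec using (Vec; []; _∷_; _++_; lookup)
open import Data.Vec.Functional using (Vector)
open import Function.Base using (_∘_; const)
open import Function.Bundles using (_⇔_)
open import Relation.Binary.Bundles using (Setoid)
import Relation.Binary.Construct.NonStrictToStrict as ToStrict
import Relation.Binary.Construct.On as On
open import Relation.Binary.Construct.Closure.Transitive using (TransClosure)
open import Relation.Binary.Core using (Rel)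
open import Relation.Binary.PropositionalEquality.Core using (_≢_)
open import Relation.Binary.Structures using (IsTotalOrder)
open import Relation.Nullary.Decidable.Core using (does)
open import Relation.Nullary.Negation.Core using (¬_)
open import Relation.Unary using (Pred)

-- The real numbers, characterised up to isomorphism as the Dedekind-complete
-- ordered field.  The value of 0# ⁻¹ is unspecified.
record CompleteOrderedField : Set₁ where
  infix  4 _≤_
  infix  8 _⁻¹
  field
    commutativeRing : CommutativeRing 0ℓ 0ℓ

  open CommutativeRing commutativeRing public

  field
    _≤_          : Rel Carrier 0ℓ
    isTotalOrder : IsTotalOrder _≈_ _≤_

  open ToStrict _≈_ _≤_ public using (_<_)

  IsUpperBound : Pred Carrier 0ℓ → Carrier → Set
  IsUpperBound S u = ∀ x → S x → x ≤ u

  field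
    0<1       : 0# < 1#
    +-monoˡ-≤ : ∀ z {x y} → x ≤ y → x + z ≤ y + z
    *-nonNeg  : ∀ {x y} → 0# ≤ x → 0# ≤ y → 0# ≤ x * y
    _⁻¹       : Carrier → Carrier
    *-inverse : ∀ x → x ≉ 0# → x * x ⁻¹ ≈ 1#
    supremum  : (S : Pred Carrier 0ℓ) → ∃ S → ∃ (IsUpperBound S) →
                ∃ λ s → IsUpperBound S s × (∀ u → IsUpperBound S u → s ≤ u)

record Signature : Set where
  field
    size  : ℕ
    arity : Fin size → ℕ

  Symbol : Set
  Symbol = Fin size

open Signature public

∅ : Signature
∅ = record { size = 0 ; arity = λ () }

embed : ∀ {k} (S : Subset k) → Fin ∣ S ∣ → Fin k
embed (outside ∷ S) i       = suc (embed S i)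
embed (inside  ∷ S) zero    = zero
embed (inside  ∷ S) (suc i) = suc (embed S i)

infixl 6 _∣ₛ_
_∣ₛ_ : (σ : Signature) → Subset (size σ) → Signature
σ ∣ₛ S = record { size = ∣ S ∣ ; arity = arity σ ∘ embed S }

-- The σ-structures with domain [N], which is rendered as Fin N.
Structure : Signature → ℕ → Set
Structure σ N = (R : Symbol σ) → Vec (Fin N) (arity σ R) → Bool

reduct : ∀ {σ N} (S : Subset (size σ)) → Structure σ N → Structure (σ ∣ₛ S) N
reduct S A R = A (embed S R)

∅-structure : ∀ {N} → Structure ∅ N
∅-structure ()

choices : ∀ {k} {B : Fin k → Set} → (∀ i → List (B i)) → List (∀ i → B i)
choices {zero}      L = (λ ()) ∷ []
choices {suc k} {B} L = cartesianProductWith cons (L zero) (choices (L ∘ suc))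
  where
  cons : B zero → (∀ i → B (suc i)) → ∀ i → B i
  cons b f zero    = b
  cons b f (suc i) = f i

relations : ∀ N k → List (Vec (Fin N) k → Bool)
relations N zero    = const false ∷ const true ∷ []
relations N (suc k) = List.map (λ f → λ { (a ∷ as) → f a as })
                               (choices (λ (_ : Fin N) → relations N k))

-- The set 𝐖_N: up to pointwise equality, every σ-structure with domain [N]
-- occurs exactly once.
structures : ∀ σ N → List (Structure σ N)
structures σ N = choices (λ R → relations N (arity σ R))

tuples : ∀ N k → List (Vec (Fin N) k)
tuples N zero    = [] ∷ []
tuples N (suc k) = cartesianProductWith _∷_ (allFin N) (tuples N k)

-- Formulas φ(x̄) are well scoped: with |x̄| = n, the variables are the elements
-- of Fin n.  A binder for ȳ with |ȳ| = m has a body over the n + m variables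
-- (x̄, ȳ), evaluated at ā ++ b̄.
data Atom (σ : Signature) (n : ℕ) : Set where
  _≐_ : Fin n → Fin n → Atom σ n
  rel : (R : Symbol σ) → Vec (Fin n) (arity σ R) → Atom σ n

data Literal (σ : Signature) (n : ℕ) : Set where
  pos neg : Atom σ n → Literal σ n

module _ {σ : Signature} where

  evalAtom : ∀ {N n} → Structure σ N → Vec (Fin N) n → Atom σ n → Bool
  evalAtom A a (x ≐ y)    = does (lookup a x ≟ lookup a y)
  evalAtom A a (rel R xs) = A R (Vec.map (lookup a) xs)

  evalLiteral : ∀ {N n} → Structure σ N → Vec (Fin N) n → Literal σ n → Bool
  evalLiteral A a (pos α) = evalAtom A a α
  evalLiteral A a (neg α) = not (evalAtom A a α)

  evalLiterals : ∀ {N n} → Structure σ N → Vec (Fin N) n → List (Literal σ n) → Bool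
  evalLiterals A a = List.all (evalLiteral A a)

-- A satisfiable set of literals is satisfiable in a finite structure, so
-- consistency may refer to these only.  Domains of models are nonempty.
record AtomicType (σ : Signature) (n : ℕ) : Set where
  field
    literals   : List (Literal σ n)
    consistent : ∃ λ N → Σ (Structure σ (suc N)) λ A →
                 ∃ λ a → T (evalLiterals A a literals)

open AtomicType public

Complete : ∀ {σ n} → AtomicType σ n → Set
Complete {σ} {n} p = (α : Atom σ n) → pos α ∈ literals p ⊎ neg α ∈ literals p

-- Excluded middle makes this the classical theory; the definitions use it to
-- count the elements of a finite list that satisfy an arbitrary predicate.
module Theory (em : ExcludedMiddle 0ℓ) (ℝ : CompleteOrderedField) where

  open CompleteOrderedField ℝ
  open import Algebra.Definitions.RawMonoid +-rawMonoid using () renaming (_×_ to _·_)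

  ∣_∣ᵣ : Carrier → Carrier
  ∣ x ∣ᵣ = [ const x , const (- x) ]′ (IsTotalOrder.total isTotalOrder 0# x)

  fromℕ : ℕ → Carrier
  fromℕ k = k · 1#

  sum product : List Carrier → Carrier
  sum     = List.foldr _+_ 0#
  product = List.foldr _*_ 1#

  Limit : (ℕ → Carrier) → Carrier → Set
  Limit x ℓ = ∀ ε → 0# < ε → ∃ λ N → ∀ n → N ℕ.≤ n → ∣ x n - ℓ ∣ᵣ < ε

  record 𝕀 : Set where
    field
      val : Carrier
      0≤  : 0# ≤ val
      ≤1  : val ≤ 1#

  open 𝕀 public

  𝟘 𝟙 : 𝕀
  𝟘 = record { val = 0# ; 0≤ = IsTotalOrder.refl isTotalOrder ; ≤1 = proj₁ 0<1 }
  𝟙 = record { val = 1# ; 0≤ = proj₁ 0<1 ; ≤1 = IsTotalOrder.refl isTotalOrder }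

  𝕀-setoid : Setoid 0ℓ 0ℓ
  𝕀-setoid = On.setoid setoid val

  open Permutation 𝕀-setoid using (_↭_)

  dist : 𝕀 → 𝕀 → Carrier
  dist u v = ∣ val u - val v ∣ᵣ

  count : {X : Set} → Pred X 0ℓ → List X → ℕ
  count P xs = List.length (filter (λ x → em {P x}) xs)

  -- Endpoints range over all of ℝ, so the sets {x ∈ [0,1] : lower < x < upper}
  -- are exactly the intervals open in [0,1], including those containing 0 or 1.
  record Interval : Set where
    field
      lower upper : Carrier

  open Interval public

  _∈ᵢ_ : 𝕀 → Interval → Set
  x ∈ᵢ I = lower I < val x × val x < upper I

  record Parameters : Set where
    field
      {k} : ℕ
      c α : Vector 𝕀 k

  -- The cᵢ are required to be distinct: otherwise there is no disjoint family
  -- of intervals with cᵢ ∈ Iᵢ, and the second condition would be vacuous.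
  record ConvergenceTesting (r : ℕ → List⁺ 𝕀) (params : Parameters) : Set where
    open Parameters params
    field
      increasing : ∀ n → List⁺.length (r n) ℕ.< List⁺.length (r (suc n))
      distinct   : ∀ i j → i ≢ j → val (c i) ≉ val (c j)
      converging : (I : Vector Interval k) →
        (∀ i j → i ≢ j → ∀ x → ¬ (x ∈ᵢ I i × x ∈ᵢ I j)) →
        (∀ i → c i ∈ᵢ I i) →
        (∃ λ N → ∀ n → N ℕ.≤ n → All (λ x → ∃ λ j → x ∈ᵢ I j) (toList (r n))) ×
        (∀ j → Limit (λ n → fromℕ (count (_∈ᵢ I j) (toList (r n)))
                            * fromℕ (List⁺.length (r n)) ⁻¹)
                     (val (α j)))

  record StronglyAdmissible (m : ℕ) : Set where
    field
      apply       : Vector (List⁺ 𝕀) m → 𝕀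
      symmetric   : ∀ r s → (∀ i → toList (r i) ↭ toList (s i)) →
                    val (apply r) ≈ val (apply s)
      -- Pointwise forces the sequences to have equal lengths, so this is
      -- continuity on each [0,1]^n₁ × ⋯ × [0,1]^nₘ.
      continuous  : ∀ r ε → 0# < ε → ∃ λ δ → 0# < δ ×
                    (∀ s → (∀ i → Pointwise (λ x y → dist x y < δ)
                                            (toList (r i)) (toList (s i))) →
                           dist (apply r) (apply s) < ε)
      convergence : (r ρ : ℕ → Vector (List⁺ 𝕀) m) (params : Vector Parameters m) →
                    (∀ i → ConvergenceTesting (λ n → r n i) (params i)) →
                    (∀ i → ConvergenceTesting (λ n → ρ n i) (params i)) →
                    Limit (λ n → dist (apply (r n)) (apply (ρ n))) 0#

  record Connective (k : ℕ) : Set where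
    field
      apply      : Vector 𝕀 k → 𝕀
      continuous : ∀ u ε → 0# < ε → ∃ λ δ → 0# < δ ×
                   (∀ v → (∀ i → dist (u i) (v i) < δ) → dist (apply u) (apply v) < ε)

  data coPLA⁺ (σ : Signature) (n : ℕ) : Set where
    real  : 𝕀 → coPLA⁺ σ n
    atom  : Atom σ n → coPLA⁺ σ n
    conn  : ∀ {k} → Connective k → (Fin k → coPLA⁺ σ n) → coPLA⁺ σ n
    agg   : ∀ {k} m → StronglyAdmissible k → (Fin k → coPLA⁺ σ (n ℕ.+ m)) →
            AtomicType ∅ (n ℕ.+ m) → coPLA⁺ σ n

  value : ∀ {σ N n} → Structure σ N → coPLA⁺ σ n → Vec (Fin N) n → 𝕀
  value A (real c)    a = c
  value A (atom α)    a = if evalAtom A a α then 𝟙 else 𝟘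
  value A (conn C φ)  a = Connective.apply C (λ i → value A (φ i) a)
  value {N = N} A (agg m F φ p) a =
    aggregate (List.filterᵇ (λ b → evalLiterals ∅-structure (a ++ b) (literals p)) (tuples N m))
    where
    aggregate : List (Vec (Fin N) m) → 𝕀
    aggregate []       = 𝟘
    aggregate (b ∷ bs) =
      StronglyAdmissible.apply F (λ i → List⁺.map (λ b → value A (φ i) (a ++ b)) (b ∷ bs))

  record Network (σ : Signature) : Set where
    field
      par     : Symbol σ → Subset (size σ)
      acyclic : ∀ R → ¬ TransClosure (λ Q R → Q ∈ˢ par R) R R
      θ       : ∀ R → coPLA⁺ (σ ∣ₛ par R) (arity σ R)

    PathTo : ℕ → Symbol σ → Set
    PathTo zero    R = Unit.⊤
    PathTo (suc l) R = ∃ λ Q → Q ∈ˢ par R × PathTo l Q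

    -- By acyclicity every path has length less than size σ.
    mp : Symbol σ → ℕ
    mp R = List.foldr ℕ._⊔_ 0 (filter (λ l → em {PathTo l R}) (upTo (size σ)))

    ρ : ℕ
    ρ = List.foldr ℕ._⊔_ 0 (List.map mp (allFin (size σ)))

    -- factor A R is the product over all ā of 𝓐′(θ_R(ā)) or 1 - 𝓐′(θ_R(ā)),
    -- according to whether ā ∈ R^𝓐.  The value of θ_R in 𝓐′ depends only on the
    -- reduct to par R.
    factor : ∀ {N} → Structure σ N → Symbol σ → Carrier
    factor {N} A R = product (List.map weight (tuples N (arity σ R)))
      where
      weight : Vec (Fin N) (arity σ R) → Carrier
      weight a = let p = val (value (reduct (par R) A) (θ R) a)
                 in if A R a then p else 1# - p

    -- For a σ-structure 𝓐, level (r + 1) 𝓐 is ℙʳ(𝓐↾σ_r); level 0 is ℙ⁻¹.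
    level : ∀ {N} → ℕ → Structure σ N → Carrier
    level zero    A = 1#
    level (suc r) A =
      level r A * product (List.map (factor A) (filter (λ R → mp R ℕ.≟ r) (allFin (size σ))))

    weightOf : ∀ {N} → Structure σ N → Carrier
    weightOf = level (suc ρ)

    ℙ : ∀ N → Pred (Structure σ N) 0ℓ → Carrier
    ℙ N E = sum (List.map weightOf (filter (λ A → em {E A}) (structures σ N)))

  open Network public using (ℙ)

  -- condˡ r _ m φ ψ θ τ is  r + ‖φ | ψ‖ ≥ ‖θ | τ‖  and
  -- condʳ r _ m φ ψ θ τ is  ‖φ | ψ‖ ≥ ‖θ | τ‖ + r,  binding m variables.
  data CPL (σ : Signature) (n : ℕ) : Set where
    atom                    : Atom σ n → CPL σ n
    ⊤̇ ⊥̇                     : CPL σ n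
    ¬̇_                      : CPL σ n → CPL σ n
    _∧̇_ _∨̇_ _→̇_ _↔̇_         : CPL σ n → CPL σ n → CPL σ n
    ∃̇_                      : CPL σ (n ℕ.+ 1) → CPL σ n
    condˡ condʳ             : (r : Carrier) → 0# ≤ r → (m : ℕ) →
                              (φ ψ θ τ : CPL σ (n ℕ.+ m)) → CPL σ n

  infix  9 ¬̇_ ∃̇_
  infixr 7 _∧̇_
  infixr 6 _∨̇_
  infixr 5 _→̇_ _↔̇_

  card : ∀ {N m} → Pred (Vec (Fin N) m) 0ℓ → ℕ
  card {N} {m} P = count P (tuples N m)

  -- |P ∩ Q| / |Q|, meaningful only for nonempty Q.
  proportion : ∀ {N m} (P Q : Pred (Vec (Fin N) m) 0ℓ) → Carrier
  proportion P Q = fromℕ (card (λ b → P b × Q b)) * fromℕ (card Q) ⁻¹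

  infix 4 _⊨_[_]
  _⊨_[_] : ∀ {σ N n} → Structure σ N → CPL σ n → Vec (Fin N) n → Set
  A ⊨ atom α [ a ] = T (evalAtom A a α)
  A ⊨ ⊤̇      [ a ] = Unit.⊤
  A ⊨ ⊥̇      [ a ] = Empty.⊥
  A ⊨ ¬̇ φ    [ a ] = ¬ (A ⊨ φ [ a ])
  A ⊨ φ ∧̇ ψ  [ a ] = (A ⊨ φ [ a ]) × (A ⊨ ψ [ a ])
  A ⊨ φ ∨̇ ψ  [ a ] = (A ⊨ φ [ a ]) ⊎ (A ⊨ ψ [ a ])
  A ⊨ φ →̇ ψ  [ a ] = A ⊨ φ [ a ] → A ⊨ ψ [ a ]
  A ⊨ φ ↔̇ ψ  [ a ] = (A ⊨ φ [ a ]) ⇔ (A ⊨ ψ [ a ])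
  A ⊨ ∃̇ φ    [ a ] = ∃ λ b → A ⊨ φ [ a ++ b ∷ [] ]
  A ⊨ condˡ r _ m φ ψ θ τ [ a ] =
    (∃ λ b → A ⊨ ψ [ a ++ b ]) × (∃ λ b → A ⊨ τ [ a ++ b ]) ×
    proportion (λ b → A ⊨ θ [ a ++ b ]) (λ b → A ⊨ τ [ a ++ b ])
      ≤ r + proportion (λ b → A ⊨ φ [ a ++ b ]) (λ b → A ⊨ ψ [ a ++ b ])
  A ⊨ condʳ r _ m φ ψ θ τ [ a ] =
    (∃ λ b → A ⊨ ψ [ a ++ b ]) × (∃ λ b → A ⊨ τ [ a ++ b ]) ×
    proportion (λ b → A ⊨ θ [ a ++ b ]) (λ b → A ⊨ τ [ a ++ b ]) + r
      ≤ proportion (λ b → A ⊨ φ [ a ++ b ]) (λ b → A ⊨ ψ [ a ++ b ])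

  data QuantifierFree {σ n} : CPL σ n → Set where
    atom : ∀ α → QuantifierFree (atom α)
    ⊤̇    : QuantifierFree ⊤̇
    ⊥̇    : QuantifierFree ⊥̇
    ¬̇_   : ∀ {φ} → QuantifierFree φ → QuantifierFree (¬̇ φ)
    _∧̇_  : ∀ {φ ψ} → QuantifierFree φ → QuantifierFree ψ → QuantifierFree (φ ∧̇ ψ)
    _∨̇_  : ∀ {φ ψ} → QuantifierFree φ → QuantifierFree ψ → QuantifierFree (φ ∨̇ ψ)
    _→̇_  : ∀ {φ ψ} → QuantifierFree φ → QuantifierFree ψ → QuantifierFree (φ →̇ ψ)
    _↔̇_  : ∀ {φ ψ} → QuantifierFree φ → QuantifierFree ψ → QuantifierFree (φ ↔̇ ψ)

  data Immediate {σ n} : ∀ {k} → CPL σ k → CPL σ n → Set where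
    ¬-sub             : ∀ {φ} → Immediate φ (¬̇ φ)
    ∧-subˡ            : ∀ {φ ψ} → Immediate φ (φ ∧̇ ψ)
    ∧-subʳ            : ∀ {φ ψ} → Immediate ψ (φ ∧̇ ψ)
    ∨-subˡ            : ∀ {φ ψ} → Immediate φ (φ ∨̇ ψ)
    ∨-subʳ            : ∀ {φ ψ} → Immediate ψ (φ ∨̇ ψ)
    →-subˡ            : ∀ {φ ψ} → Immediate φ (φ →̇ ψ)
    →-subʳ            : ∀ {φ ψ} → Immediate ψ (φ →̇ ψ)
    ↔-subˡ            : ∀ {φ ψ} → Immediate φ (φ ↔̇ ψ)
    ↔-subʳ            : ∀ {φ ψ} → Immediate ψ (φ ↔̇ ψ)
    ∃-sub             : ∀ {φ} → Immediate φ (∃̇ φ)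
    condˡ-sub₁        : ∀ {r r≥0 m φ ψ θ τ} → Immediate φ (condˡ r r≥0 m φ ψ θ τ)
    condˡ-sub₂        : ∀ {r r≥0 m φ ψ θ τ} → Immediate ψ (condˡ r r≥0 m φ ψ θ τ)
    condˡ-sub₃        : ∀ {r r≥0 m φ ψ θ τ} → Immediate θ (condˡ r r≥0 m φ ψ θ τ)
    condˡ-sub₄        : ∀ {r r≥0 m φ ψ θ τ} → Immediate τ (condˡ r r≥0 m φ ψ θ τ)
    condʳ-sub₁        : ∀ {r r≥0 m φ ψ θ τ} → Immediate φ (condʳ r r≥0 m φ ψ θ τ)
    condʳ-sub₂        : ∀ {r r≥0 m φ ψ θ τ} → Immediate ψ (condʳ r r≥0 m φ ψ θ τ)
    condʳ-sub₃        : ∀ {r r≥0 m φ ψ θ τ} → Immediate θ (condʳ r r≥0 m φ ψ θ τ)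
    condʳ-sub₄        : ∀ {r r≥0 m φ ψ θ τ} → Immediate τ (condʳ r r≥0 m φ ψ θ τ)

  infix 4 _⊑_
  data _⊑_ {σ k} (χ : CPL σ k) : ∀ {n} → CPL σ n → Set where
    ⊑-refl : χ ⊑ χ
    ⊑-step : ∀ {m n} {φ : CPL σ m} {ψ : CPL σ n} → χ ⊑ φ → Immediate φ ψ → χ ⊑ ψ

  weakenAtom : ∀ {σ n} m → Atom σ n → Atom σ (n ℕ.+ m)
  weakenAtom m (x ≐ y)    = (x ↑ˡ m) ≐ (y ↑ˡ m)
  weakenAtom m (rel R xs) = rel R (Vec.map (_↑ˡ m) xs)

  -- The conjunction of q(x̄), as a formula in the variables (x̄, ȳ).
  ⋀ : ∀ {σ n} m → AtomicType σ n → CPL σ (n ℕ.+ m)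
  ⋀ {σ} {n} m q = List.foldr _∧̇_ ⊤̇ (List.map formula (literals q))
    where
    formula : Literal σ n → CPL σ (n ℕ.+ m)
    formula (pos α) = atom (weakenAtom m α)
    formula (neg α) = ¬̇ atom (weakenAtom m α)

  module _ {σ : Signature} (G : Network σ) where

    -- α is the saturation number of ‖ψ(x̄,ȳ) | θ(x̄,ȳ)‖_ȳ, where θ entails q(x̄).
    -- A tuple ā with θ(ā,𝓐) = ∅, whose proportion is undefined, counts as one
    -- whose proportion is not within ε of α.  If such ā were ignored, ‖⊥ | θ‖ would
    -- have saturation number 0 for a θ that is satisfied only with some
    -- probability strictly between 0 and 1.
    IsSaturationNumber : ∀ {n} → AtomicType σ n → ∀ m → (ψ θ : CPL σ (n ℕ.+ m)) → 𝕀 → Set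
    IsSaturationNumber q m ψ θ α =
      ∀ ε → 0# < ε → Limit (λ N → ℙ G N (λ A → ∃ λ a → T (evalLiterals A a (literals q)) ×
        (¬ (∃ λ b → A ⊨ θ [ a ++ b ]) ⊎
         ε < ∣ val α - proportion (λ b → A ⊨ ψ [ a ++ b ]) (λ b → A ⊨ θ [ a ++ b ]) ∣ᵣ))) 0#

    -- If the probability that q is realised tends to 0, every α is a saturation
    -- number; in all other cases α₁ and α₂ are unique.
    SafeConditional : ∀ {n} → Carrier → ∀ m → (ψ₁ θ₁ ψ₂ θ₂ : CPL σ (n ℕ.+ m)) → Set
    SafeConditional {n} r m ψ₁ θ₁ ψ₂ θ₂ =
      (q : AtomicType σ n) → Complete q →
      (∃ λ N → Σ (Structure σ (suc N)) λ A → ∃ λ a → ∃₂ λ b b′ →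
        (A ⊨ θ₁ [ a ++ b ]) × (A ⊨ θ₂ [ a ++ b′ ]) × T (evalLiterals A a (literals q))) →
      ∃₂ λ α₁ α₂ → IsSaturationNumber q m ψ₁ (θ₁ ∧̇ ⋀ m q) α₁ ×
                   IsSaturationNumber q m ψ₂ (θ₂ ∧̇ ⋀ m q) α₂ ×
                   r ≉ ∣ val α₁ - val α₂ ∣ᵣ

    record Safe {n} (φ : CPL σ n) : Set where
      field
        noQuantifiers    : ∀ {k} {χ : CPL σ (k ℕ.+ 1)} → ¬ (∃̇ χ ⊑ φ)
        safeConditionalˡ : ∀ {k r r≥0 m} {ψ₁ θ₁ ψ₂ θ₂ : CPL σ (k ℕ.+ m)} →
                           condˡ r r≥0 m ψ₁ θ₁ ψ₂ θ₂ ⊑ φ → SafeConditional r m ψ₁ θ₁ ψ₂ θ₂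
        safeConditionalʳ : ∀ {k r r≥0 m} {ψ₁ θ₁ ψ₂ θ₂ : CPL σ (k ℕ.+ m)} →
                           condʳ r r≥0 m ψ₁ θ₁ ψ₂ θ₂ ⊑ φ → SafeConditional r m ψ₁ θ₁ ψ₂ θ₂

    AlmostSurelyEquivalent : ∀ {n} → CPL σ n → CPL σ n → Set
    AlmostSurelyEquivalent φ ψ =
      Limit (λ N → ℙ G N (λ A → ∀ a → (A ⊨ φ [ a ]) ⇔ (A ⊨ ψ [ a ]))) 1#

{-# OPTIONS --safe #-}
module Submission where

-- Only the outermost conditionals of φ matter.  On the tuples of a complete type q
-- a conditional compares two proportions that, outside an event of vanishing
-- probability, are uniformly within ε of the saturation numbers α₁ and α₂; as
-- r ≠ |α₁ - α₂|, for small ε all these tuples give the same answer.  So φ is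
-- almost surely decided by the type, of which there are finitely many.
--
-- This uses of ℙ only that it is a probability measure.  Its total mass is
-- computed by integrating out the relation symbols in order of decreasing mp: the
-- factor of R sums to 1 over the interpretations of R, and none of the remaining
-- factors depends on R.  To avoid uniform weights, integrating out R is an identity
-- between sums over all structures, with the number of interpretations of R as a
-- factor on one side; these numbers cancel at the end.

open import Level using (0ℓ)
open import Axiom.ExcludedMiddle using (ExcludedMiddle)
open import Data.Nat.Base using (ℕ)
open import Data.Product.Base using (∃; _×_)
open import Defs
open import Algebra.Bundles using (CommutativeMonoid)
import Algebra.Properties.AbelianGroup
import Algebra.Properties.CommutativeSemigroup
open import Data.Bool.Base using (Bool; true; false; if_then_else_; not; T)
open import Data.Bool.Properties using (T-∧)
open import Data.Fin.Base as Fin using (Fin; zero; suc)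
import Data.Fin.Properties as Fin
open import Data.Fin.Subset using (Subset; inside; outside) renaming (_∈_ to _∈ˢ_)
open import Data.List.Base as List using (List; []; _∷_; allFin; filter; map; cartesianProductWith)
open import Data.List.Membership.Propositional using (_∈_)
open import Data.List.Membership.Propositional.Properties
  using (∈-allFin; ∈-filter⁺; ∈-filter⁻; ∈-upTo⁺; ∈-map⁺; ∈-++⁺ˡ; ∈-++⁺ʳ;
         ∈-cartesianProductWith⁺; ∈-concatMap⁺; foldr-selective)
open import Data.List.Properties using (map-∘; map-tabulate; filter-all; filter-none; filter-≐)
open import Data.List.Relation.Unary.All as All using (All; []; _∷_)
open import Data.List.Relation.Unary.All.Properties using (all-filter)
open import Data.List.Relation.Unary.AllPairs using ([]; _∷_)
open import Data.List.Relation.Unary.Any as Any using (here; there)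
open import Data.List.Relation.Unary.Unique.Propositional using (Unique)
import Data.List.Relation.Unary.Unique.Propositional.Properties as Unique
import Data.List.Relation.Binary.Pointwise as Pointwise
import Data.List.Relation.Binary.Permutation.Setoid as Permutation
open import Data.Nat.Base as ℕ using (zero; suc; s≤s; z≤n)
import Data.Nat.Properties as ℕ
open import Data.Product.Base using (∃₂; Σ; _,_; proj₁; proj₂)
open import Data.Sum.Base using (_⊎_; inj₁; inj₂; [_,_]′)
open import Data.Unit.Base using (tt)
open import Data.Vec.Base as Vec using (Vec; []; _∷_; _++_)
import Data.Vec.Properties as Vec
open import Data.Product.Function.NonDependent.Propositional using (_×-cong_)
open import Data.Sum.Function.Propositional using (_⊎-cong_)
open import Function.Base using (_∘_; id; const; _$_)
open import Function.Bundles using (_⇔_; mk⇔; Equivalence)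
open import Function.Related.TypeIsomorphisms using (¬-cong-⇔; →-cong-⇔; Related-cong)
open import Relation.Binary.Bundles using (Poset)
open import Relation.Binary.Construct.Closure.Transitive using (TransClosure; [_]; _∷ʳ_)
open import Relation.Binary.PropositionalEquality.Core as ≡ using (_≡_; _≢_; cong; subst)
import Relation.Binary.Reasoning.PartialOrder as PartialOrderReasoning
open import Relation.Binary.Structures using (IsTotalOrder)
import Relation.Binary.Construct.NonStrictToStrict as ToStrict
open import Relation.Nullary.Decidable.Core using (yes; no; does; decidable-stable; toSum)
open import Relation.Nullary.Negation.Core using (¬_; contradiction)
open import Relation.Unary using (Pred; Decidable)

open Equivalence using (to; from)

-- Dependent functions on a finite index set, and enumerations of finite objects.

update : ∀ {k} {B : Fin k → Set} (i : Fin k) → B i → (∀ j → B j) → ∀ j → B j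
update zero    x f zero    = x
update zero    x f (suc j) = f (suc j)
update (suc i) x f zero    = f zero
update (suc i) x f (suc j) = update i x (f ∘ suc) j

update-same : ∀ {k} {B : Fin k → Set} (i : Fin k) (x : B i) (f : ∀ j → B j) → update i x f i ≡ x
update-same zero    x f = ≡.refl
update-same (suc i) x f = update-same i x (f ∘ suc)

update-other : ∀ {k} {B : Fin k → Set} (i : Fin k) (x : B i) (f : ∀ j → B j) {j} →
               i ≢ j → update i x f j ≡ f j
update-other zero    x f {zero}  i≢j = contradiction ≡.refl i≢j
update-other zero    x f {suc j} i≢j = ≡.refl
update-other (suc i) x f {zero}  i≢j = ≡.refl
update-other (suc i) x f {suc j} i≢j = update-other i x (f ∘ suc) (i≢j ∘ cong suc)

update-cong : ∀ {k} {B : Fin k → Set} (i : Fin k) (x : B i) {f g : ∀ j → B j} →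
              (∀ j → f j ≡ g j) → ∀ j → update i x f j ≡ update i x g j
update-cong zero    x eq zero    = ≡.refl
update-cong zero    x eq (suc j) = eq (suc j)
update-cong (suc i) x eq zero    = eq zero
update-cong (suc i) x eq (suc j) = update-cong i x (eq ∘ suc) j

-- The `cons` inside `choices` cannot be named from outside. This copy agrees with it only
-- pointwise, hence the appeals to extensionality in `Σ⁺-choices`.
cons : ∀ {k} {B : Fin (suc k) → Set} → B zero → (∀ i → B (suc i)) → ∀ i → B i
cons b f zero    = b
cons b f (suc i) = f i

-- Ensures that the number of structures is not zero, so that it can be cancelled in `total-mass`.
choices-inhabited : ∀ {k} {B : Fin k → Set} (L : ∀ i → List (B i)) →
                    (∀ i → ∃ (_∈ L i)) → ∃ (_∈ choices L)
choices-inhabited {zero}  L inh = _ , here ≡.refl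
choices-inhabited {suc k} L inh =
  _ , ∈-cartesianProductWith⁺ _ (proj₂ (inh zero))
                                (proj₂ (choices-inhabited (L ∘ suc) (inh ∘ suc)))

relations-inhabited : ∀ N k → ∃ (_∈ relations N k)
relations-inhabited N zero    = _ , here ≡.refl
relations-inhabited N (suc k) =
  _ , ∈-map⁺ _ (proj₂ (choices-inhabited (λ _ → relations N k) (λ _ → relations-inhabited N k)))

embed-∈ : ∀ {k} (S : Subset k) i → embed S i ∈ˢ S
embed-∈ (outside ∷ S) i       = Vec.there (embed-∈ S i)
embed-∈ (inside  ∷ S) zero    = Vec.here
embed-∈ (inside  ∷ S) (suc i) = Vec.there (embed-∈ S i)

¬T⇒T-not : ∀ {b} → ¬ T b → T (not b)
¬T⇒T-not {true}  ¬t = ¬t tt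
¬T⇒T-not {false} ¬t = tt

T-not⇒¬T : ∀ {b} → T (not b) → ¬ T b
T-not⇒¬T {false} _ ()

∈-tuples : ∀ {N k} (a : Vec (Fin N) k) → a ∈ tuples N k
∈-tuples []       = here ≡.refl
∈-tuples (a ∷ as) = ∈-cartesianProductWith⁺ _∷_ (∈-allFin a) (∈-tuples as)

atoms : ∀ σ n → List (Atom σ n)
atoms σ n = cartesianProductWith _≐_ (allFin n) (allFin n) List.++
            List.concatMap (λ R → map (rel R) (tuples n (arity σ R))) (allFin (size σ))

∈-atoms : ∀ {σ n} (α : Atom σ n) → α ∈ atoms σ n
∈-atoms (x ≐ y)    = ∈-++⁺ˡ (∈-cartesianProductWith⁺ _≐_ (∈-allFin x) (∈-allFin y))
∈-atoms (rel R xs) = ∈-++⁺ʳ _ (∈-concatMap⁺ _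
  (Any.map (λ { ≡.refl → ∈-map⁺ (rel R) (∈-tuples xs) }) (∈-allFin R)))

-- Iterated operations in a commutative monoid, for sums and products alike.

module BigOperator (M : CommutativeMonoid 0ℓ 0ℓ) where
  open CommutativeMonoid M
  open Algebra.Properties.CommutativeSemigroup commutativeSemigroup using (interchange; x∙yz≈y∙xz)
  open import Relation.Binary.Reasoning.Setoid setoid

  big : {X : Set} → (X → Carrier) → List X → Carrier
  big f xs = List.foldr _∙_ ε (map f xs)

  big-cong-All : {X : Set} {f g : X → Carrier} {xs : List X} →
                 All (λ x → f x ≈ g x) xs → big f xs ≈ big g xs
  big-cong-All []         = refl
  big-cong-All (eq ∷ eqs) = ∙-cong eq (big-cong-All eqs)

  big-cong : {X : Set} {f g : X → Carrier} (xs : List X) → (∀ x → f x ≈ g x) → big f xs ≈ big g xs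
  big-cong xs eq = big-cong-All (All.universal eq xs)

  big-ε : {X : Set} (xs : List X) → big (const ε) xs ≈ ε
  big-ε []       = refl
  big-ε (x ∷ xs) = trans (identityˡ _) (big-ε xs)

  big-∙ : {X : Set} (f g : X → Carrier) (xs : List X) →
          big (λ x → f x ∙ g x) xs ≈ big f xs ∙ big g xs
  big-∙ f g []       = sym (identityˡ ε)
  big-∙ f g (x ∷ xs) = trans (∙-congˡ (big-∙ f g xs)) (interchange _ _ _ _)

  big-++ : {X : Set} (f : X → Carrier) (xs ys : List X) → big f (xs List.++ ys) ≈ big f xs ∙ big f ys
  big-++ f []       ys = sym (identityˡ _)
  big-++ f (x ∷ xs) ys = trans (∙-congˡ (big-++ f xs ys)) (sym (assoc _ _ _))

  big-map : {X Y : Set} (f : Y → Carrier) (g : X → Y) (xs : List X) → big f (map g xs) ≡ big (f ∘ g) xs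
  big-map f g xs = cong (List.foldr _∙_ ε) (≡.sym (map-∘ xs))

  big-cartesianProductWith : {X Y Z : Set} (h : Z → Carrier) (f : X → Y → Z) (xs : List X) (ys : List Y) →
    big h (cartesianProductWith f xs ys) ≈ big (λ x → big (λ y → h (f x y)) ys) xs
  big-cartesianProductWith h f []       ys = refl
  big-cartesianProductWith h f (x ∷ xs) ys = begin
    big h (map (f x) ys List.++ cartesianProductWith f xs ys)
      ≈⟨ big-++ h (map (f x) ys) _ ⟩
    big h (map (f x) ys) ∙ big h (cartesianProductWith f xs ys)
      ≈⟨ ∙-cong (reflexive (big-map h (f x) ys)) (big-cartesianProductWith h f xs ys) ⟩
    _ ∎

  big-swap : {X Y : Set} (f : X → Y → Carrier) (xs : List X) (ys : List Y) →
             big (λ x → big (f x) ys) xs ≈ big (λ y → big (λ x → f x y) xs) ys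
  big-swap f []       ys = sym (big-ε ys)
  big-swap f (x ∷ xs) ys = trans (∙-congˡ (big-swap f xs ys)) (sym (big-∙ _ _ ys))

  big-allFin : ∀ {k} (f : Fin (suc k) → Carrier) →
               big f (allFin (suc k)) ≡ f zero ∙ big (f ∘ suc) (allFin k)
  big-allFin {k} f = cong (λ fs → f zero ∙ List.foldr _∙_ ε fs)
    (≡.trans (map-tabulate suc f) (≡.sym (map-tabulate id (f ∘ suc))))

  -- Three separate deciders allow `mp R < suc r` to be split into `mp R < r` and `mp R ≡ r` in
  -- `layers-Π`.
  big-filter-⊎ : {X : Set} {P Q R : Pred X 0ℓ} (P? : Decidable P) (Q? : Decidable Q) (R? : Decidable R) →
    (∀ {x} → P x → R x) → (∀ {x} → Q x → R x) → (∀ {x} → R x → P x ⊎ Q x) →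
    (∀ {x} → P x → ¬ Q x) → (f : X → Carrier) (xs : List X) →
    big f (filter R? xs) ≈ big f (filter P? xs) ∙ big f (filter Q? xs)
  big-filter-⊎ P? Q? R? P⊆R Q⊆R R⊆P∪Q P∩Q f [] = sym (identityˡ ε)
  big-filter-⊎ P? Q? R? P⊆R Q⊆R R⊆P∪Q P∩Q f (x ∷ xs)
    with ih ← big-filter-⊎ P? Q? R? P⊆R Q⊆R R⊆P∪Q P∩Q f xs | P? x | Q? x | R? x
  ... | yes p | yes q | _     = contradiction q (P∩Q p)
  ... | yes p | no  _ | no ¬r = contradiction (P⊆R p) ¬r
  ... | no  _ | yes q | no ¬r = contradiction (Q⊆R q) ¬r
  ... | no ¬p | no ¬q | yes r = contradiction (R⊆P∪Q r) [ ¬p , ¬q ]′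
  ... | yes _ | no  _ | yes _ = trans (∙-congˡ ih) (sym (assoc _ _ _))
  ... | no  _ | yes _ | yes _ = trans (∙-congˡ ih) (x∙yz≈y∙xz _ _ _)
  ... | no  _ | no  _ | no  _ = ih

-- Arithmetic in an ordered field, and stability of inequalities.

module OrderedField (ℝ : CompleteOrderedField) where
  open CompleteOrderedField ℝ hiding (zero)
  open Algebra.Properties.AbelianGroup +-abelianGroup using ()
    renaming (∙-cancelʳ to +-cancelʳ; ⁻¹-anti-homo‿- to -‿anti-homo‿-; ε⁻¹≈ε to -0≈0)
  open Algebra.Properties.CommutativeSemigroup +-commutativeSemigroup using (xy∙z≈xz∙y)

  open IsTotalOrder isTotalOrder public using (antisym; total)
    renaming (refl to ≤-refl; reflexive to ≤-reflexive; trans to ≤-trans)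

  poset : Poset 0ℓ 0ℓ 0ℓ
  poset = record { isPartialOrder = IsTotalOrder.isPartialOrder isTotalOrder }

  module ≤-Reasoning = PartialOrderReasoning poset
  open ≤-Reasoning

  -- Has the body of `∣_∣ᵣ`, whose module also takes excluded middle. The two are definitionally
  -- equal and are mixed freely below.
  ∣_∣ : Carrier → Carrier
  ∣ x ∣ = [ const x , const (- x) ]′ (total 0# x)

  x+z-z≈x : ∀ x z → (x + z) - z ≈ x
  x+z-z≈x x z = trans (+-assoc x z (- z)) (trans (+-congˡ (-‿inverseʳ z)) (+-identityʳ x))

  x-z+z≈x : ∀ x z → (x - z) + z ≈ x
  x-z+z≈x x z = trans (+-assoc x (- z) z) (trans (+-congˡ (-‿inverseˡ z)) (+-identityʳ x))

  x-0≈x : ∀ x → x - 0# ≈ x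
  x-0≈x x = trans (+-congˡ -0≈0) (+-identityʳ x)

  +-cancelʳ-≤ : ∀ z {x y} → x + z ≤ y + z → x ≤ y
  +-cancelʳ-≤ z {x} {y} x+z≤y+z = begin
    x           ≈⟨ x+z-z≈x x z ⟨
    (x + z) - z ≤⟨ +-monoˡ-≤ (- z) x+z≤y+z ⟩
    (y + z) - z ≈⟨ x+z-z≈x y z ⟩
    y           ∎

  +-mono-≤ : ∀ {x y u v} → x ≤ y → u ≤ v → x + u ≤ y + v
  +-mono-≤ {x} {y} {u} {v} x≤y u≤v = begin
    x + u ≤⟨ +-monoˡ-≤ u x≤y ⟩
    y + u ≈⟨ +-comm y u ⟩
    u + y ≤⟨ +-monoˡ-≤ y u≤v ⟩
    v + y ≈⟨ +-comm v y ⟩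
    y + v ∎

  +-monoʳ-≤ : ∀ z {x y} → x ≤ y → z + x ≤ z + y
  +-monoʳ-≤ z = +-mono-≤ ≤-refl

  +-monoˡ-< : ∀ z {x y} → x < y → x + z < y + z
  +-monoˡ-< z {x} {y} (x≤y , x≉y) = +-monoˡ-≤ z x≤y , x≉y ∘ +-cancelʳ z x y

  +-cancelʳ-< : ∀ z {x y} → x + z < y + z → x < y
  +-cancelʳ-< z (le , ne) = +-cancelʳ-≤ z le , ne ∘ +-congʳ

  +-mono-< : ∀ {x y u v} → x < y → u < v → x + u < y + v
  +-mono-< {x} {y} {u} {v} x<y u<v = begin-strict
    x + u <⟨ +-monoˡ-< u x<y ⟩
    y + u ≈⟨ +-comm y u ⟩
    u + y <⟨ +-monoˡ-< y u<v ⟩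
    v + y ≈⟨ +-comm v y ⟩
    y + v ∎

  <⇒≱ : ∀ {x y} → x < y → ¬ (y ≤ x)
  <⇒≱ (x≤y , x≉y) y≤x = x≉y (antisym x≤y y≤x)

  ≤-<-trans : ∀ {x y z} → x ≤ y → y < z → x < z
  ≤-<-trans {x} {y} {z} x≤y y<z = begin-strict x ≤⟨ x≤y ⟩ y <⟨ y<z ⟩ z ∎

  0≤⇒x≤y+x : ∀ {x y} → 0# ≤ y → x ≤ y + x
  0≤⇒x≤y+x {x} {y} 0≤y = begin
    x      ≈⟨ +-identityˡ x ⟨
    0# + x ≤⟨ +-monoˡ-≤ x 0≤y ⟩
    y + x  ∎

  x≤y⇒0≤y-x : ∀ {x y} → x ≤ y → 0# ≤ y - x
  x≤y⇒0≤y-x {x} {y} x≤y = begin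
    0#    ≈⟨ -‿inverseʳ x ⟨
    x - x ≤⟨ +-monoˡ-≤ (- x) x≤y ⟩
    y - x ∎

  x<y⇒0<y-x : ∀ {x y} → x < y → 0# < y - x
  x<y⇒0<y-x {x} {y} x<y = begin-strict
    0#    ≈⟨ -‿inverseʳ x ⟨
    x - x <⟨ +-monoˡ-< (- x) x<y ⟩
    y - x ∎

  0≤⇒-x≤0 : ∀ {x} → 0# ≤ x → - x ≤ 0#
  0≤⇒-x≤0 {x} 0≤x = begin
    - x      ≈⟨ +-identityˡ (- x) ⟨
    0# - x   ≤⟨ +-monoˡ-≤ (- x) 0≤x ⟩
    x - x    ≈⟨ -‿inverseʳ x ⟩
    0#       ∎

  ≤0⇒0≤-x : ∀ {x} → x ≤ 0# → 0# ≤ - x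
  ≤0⇒0≤-x {x} x≤0 = begin
    0#       ≈⟨ -‿inverseʳ x ⟨
    x - x    ≤⟨ +-monoˡ-≤ (- x) x≤0 ⟩
    0# - x   ≈⟨ +-identityˡ (- x) ⟩
    - x      ∎

  ∣x∣<ε : ∀ {x ε} → x < ε → - x < ε → ∣ x ∣ < ε
  ∣x∣<ε {x} x<ε -x<ε with total 0# x
  ... | inj₁ _ = x<ε
  ... | inj₂ _ = -x<ε

  x≤∣x∣ : ∀ x → x ≤ ∣ x ∣
  x≤∣x∣ x with total 0# x
  ... | inj₁ _   = ≤-refl
  ... | inj₂ x≤0 = ≤-trans x≤0 (≤0⇒0≤-x x≤0)

  -x≤∣x∣ : ∀ x → - x ≤ ∣ x ∣
  -x≤∣x∣ x with total 0# x
  ... | inj₁ 0≤x = ≤-trans (0≤⇒-x≤0 0≤x) 0≤x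
  ... | inj₂ _   = ≤-refl

  0≤⇒∣x∣≈x : ∀ {x} → 0# ≤ x → ∣ x ∣ ≈ x
  0≤⇒∣x∣≈x {x} 0≤x with total 0# x
  ... | inj₁ _   = refl
  ... | inj₂ x≤0 = antisym (≤-trans (0≤⇒-x≤0 0≤x) 0≤x) (≤-trans x≤0 (≤0⇒0≤-x x≤0))

  ≤0⇒∣x∣≈-x : ∀ {x} → x ≤ 0# → ∣ x ∣ ≈ - x
  ≤0⇒∣x∣≈-x {x} x≤0 with total 0# x
  ... | inj₂ _   = refl
  ... | inj₁ 0≤x = antisym (≤-trans x≤0 (≤0⇒0≤-x x≤0)) (≤-trans (0≤⇒-x≤0 0≤x) 0≤x)

  1+1≉0 : 1# + 1# ≉ 0#
  1+1≉0 1+1≈0 = <⇒≱ 0<1 (begin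
    1#      ≤⟨ 0≤⇒x≤y+x (proj₁ 0<1) ⟩
    1# + 1# ≈⟨ 1+1≈0 ⟩
    0#      ∎)

  halve : ∀ {g} → 0# < g → ∃ λ h → 0# < h × h + h ≈ g
  halve {g} 0<g = h , (0≤h , 0≉h) , h+h≈g
    where
    h = g * (1# + 1#) ⁻¹

    h+h≈g : h + h ≈ g
    h+h≈g = begin-equality
      h + h                           ≈⟨ +-cong (*-identityʳ h) (*-identityʳ h) ⟨
      h * 1# + h * 1#                 ≈⟨ distribˡ h 1# 1# ⟨
      h * (1# + 1#)                   ≈⟨ *-assoc g _ _ ⟩
      g * ((1# + 1#) ⁻¹ * (1# + 1#))  ≈⟨ *-congˡ (*-comm _ _) ⟩
      g * ((1# + 1#) * (1# + 1#) ⁻¹)  ≈⟨ *-congˡ (*-inverse _ 1+1≉0) ⟩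
      g * 1#                          ≈⟨ *-identityʳ g ⟩
      g                               ∎

    -- The axioms give no sign for an inverse, so the sign of `h` is read off from its double.
    ¬h≤0 : ¬ (h ≤ 0#)
    ¬h≤0 h≤0 = <⇒≱ 0<g (begin
      g       ≈⟨ h+h≈g ⟨
      h + h   ≤⟨ +-mono-≤ h≤0 h≤0 ⟩
      0# + 0# ≈⟨ +-identityˡ 0# ⟩
      0#      ∎)

    0≤h : 0# ≤ h
    0≤h = [ id , (λ h≤0 → contradiction h≤0 ¬h≤0) ]′ (total 0# h)

    0≉h : 0# ≉ h
    0≉h 0≈h = ¬h≤0 (≤-reflexive (sym 0≈h))

  -- Halving twice leaves room for strictness: in `<-stable` the two errors must not use up the
  -- whole gap.
  quarter : ∀ {g} → 0# < g → ∃ λ ε → 0# < ε × ε + ε < g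
  quarter {g} 0<g with h , 0<h , h+h≈g ← halve 0<g with ε , 0<ε , ε+ε≈h ← halve 0<h =
    ε , 0<ε , (begin-strict
      ε + ε  ≈⟨ ε+ε≈h ⟩
      h      ≈⟨ +-identityˡ h ⟨
      0# + h <⟨ +-monoˡ-< h 0<h ⟩
      h + h  ≈⟨ h+h≈g ⟩
      g      ∎)

  -- This is `∣ x - y ∣ ≤ ε` without subtraction, so that translating both points needs only
  -- monotonicity of addition.
  Close : Carrier → Carrier → Carrier → Set
  Close ε x y = y ≤ x + ε × x ≤ y + ε

  ∣x-y∣≤ε⇒Close : ∀ {x y ε} → ∣ x - y ∣ ≤ ε → Close ε x y
  ∣x-y∣≤ε⇒Close {x} {y} {ε} ∣x-y∣≤ε =
    (begin
      y             ≈⟨ x-z+z≈x y x ⟨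
      (y - x) + x   ≈⟨ +-congʳ (-‿anti-homo‿- x y) ⟨
      - (x - y) + x ≤⟨ +-monoˡ-≤ x (≤-trans (-x≤∣x∣ (x - y)) ∣x-y∣≤ε) ⟩
      ε + x         ≈⟨ +-comm ε x ⟩
      x + ε         ∎) ,
    (begin
      x             ≈⟨ x-z+z≈x x y ⟨
      (x - y) + y   ≤⟨ +-monoˡ-≤ y (≤-trans (x≤∣x∣ (x - y)) ∣x-y∣≤ε) ⟩
      ε + y         ≈⟨ +-comm ε y ⟩
      y + ε         ∎)

  Close-+ʳ : ∀ {ε x y} z → Close ε x y → Close ε (x + z) (y + z)
  Close-+ʳ z (y≤x+ε , x≤y+ε) = shift y≤x+ε , shift x≤y+ε
    where
    shift : ∀ {x y ε} → x ≤ y + ε → x + z ≤ (y + z) + ε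
    shift x≤y+ε = ≤-trans (+-monoˡ-≤ z x≤y+ε) (≤-reflexive (xy∙z≈xz∙y _ _ _))

  Close-+ˡ : ∀ {ε x y} z → Close ε x y → Close ε (z + x) (z + y)
  Close-+ˡ z (y≤x+ε , x≤y+ε) = shift y≤x+ε , shift x≤y+ε
    where
    shift : ∀ {x y ε} → x ≤ y + ε → z + x ≤ (z + y) + ε
    shift x≤y+ε = ≤-trans (+-monoʳ-≤ z x≤y+ε) (≤-reflexive (sym (+-assoc _ _ _)))

  <-stable : ∀ {x y} → x < y → ∃ λ ε → 0# < ε ×
             (∀ {x′ y′} → Close ε x x′ → Close ε y y′ → x′ < y′)
  <-stable {x} {y} x<y with ε , 0<ε , 2ε<y-x ← quarter (x<y⇒0<y-x x<y) =
    ε , 0<ε , λ {x′} {y′} (x′≤x+ε , _) (_ , y≤y′+ε) → begin-strict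
      x′    ≤⟨ x′≤x+ε ⟩
      x + ε <⟨ +-cancelʳ-< ε (begin-strict
        (x + ε) + ε  ≈⟨ +-assoc x ε ε ⟩
        x + (ε + ε)  ≈⟨ +-comm x _ ⟩
        (ε + ε) + x  <⟨ +-monoˡ-< x 2ε<y-x ⟩
        (y - x) + x  ≈⟨ x-z+z≈x y x ⟩
        y            ≤⟨ y≤y′+ε ⟩
        y′ + ε       ∎) ⟩
      y′    ∎

  -- Two distinct numbers are strictly ordered one way or the other, and `<-stable` preserves that
  -- order. The verdict is chosen before `x′` and `y′`, so it is uniform over all nearby pairs.
  ≤-stable : ∀ {x y} → x ≉ y → ∃ λ ε → 0# < ε ×
    ((∀ {x′ y′} → Close ε x x′ → Close ε y y′ → x′ ≤ y′) ⊎
     (∀ {x′ y′} → Close ε x x′ → Close ε y y′ → ¬ (x′ ≤ y′)))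
  ≤-stable {x} {y} x≉y with total x y
  ... | inj₁ x≤y with ε , 0<ε , stable ← <-stable (x≤y , x≉y) =
    ε , 0<ε , inj₁ λ x~x′ y~y′ → proj₁ (stable x~x′ y~y′)
  ... | inj₂ y≤x with ε , 0<ε , stable ← <-stable (y≤x , x≉y ∘ sym) =
    ε , 0<ε , inj₂ λ x~x′ y~y′ → <⇒≱ (stable y~y′ x~x′)

  -- Sums and products of reals over finite lists.

  open BigOperator +-commutativeMonoid public using () renaming
    ( big to Σ⁺; big-cong to Σ⁺-cong; big-∙ to Σ⁺-+; big-map to Σ⁺-map; big-swap to Σ⁺-swap
    ; big-cartesianProductWith to Σ⁺-cartesianProductWith)
  open BigOperator *-commutativeMonoid public using () renaming
    ( big to Π; big-cong to Π-cong; big-cong-All to Π-cong-All; big-ε to Π-1; big-allFin to Π-allFin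
    ; big-cartesianProductWith to Π-cartesianProductWith; big-filter-⊎ to Π-filter-⊎)

  Σ⁺-*ˡ : {X : Set} (c : Carrier) (f : X → Carrier) (xs : List X) →
          Σ⁺ (λ x → c * f x) xs ≈ c * Σ⁺ f xs
  Σ⁺-*ˡ c f []       = sym (zeroʳ c)
  Σ⁺-*ˡ c f (x ∷ xs) = trans (+-congˡ (Σ⁺-*ˡ c f xs)) (sym (distribˡ c _ _))

  Σ⁺-*ʳ : {X : Set} (c : Carrier) (f : X → Carrier) (xs : List X) →
          Σ⁺ (λ x → f x * c) xs ≈ Σ⁺ f xs * c
  Σ⁺-*ʳ c f xs = trans (Σ⁺-cong xs (λ x → *-comm _ c)) (trans (Σ⁺-*ˡ c f xs) (*-comm c _))

  -- Here and below, `Σ⁺ (const 1#) xs` plays the role of the length of `xs` as a real number.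
  Σ⁺-const : {X : Set} (c : Carrier) (xs : List X) → Σ⁺ (const c) xs ≈ Σ⁺ (const 1#) xs * c
  Σ⁺-const c xs = trans (Σ⁺-cong xs (λ _ → sym (*-identityˡ c))) (Σ⁺-*ʳ c (const 1#) xs)

  Σ⁺-mono : {X : Set} {f g : X → Carrier} (xs : List X) → (∀ x → f x ≤ g x) → Σ⁺ f xs ≤ Σ⁺ g xs
  Σ⁺-mono []       f≤g = ≤-refl
  Σ⁺-mono (x ∷ xs) f≤g = +-mono-≤ (f≤g x) (Σ⁺-mono xs f≤g)

  Σ⁺-nonNeg : {X : Set} {f : X → Carrier} (xs : List X) → (∀ x → 0# ≤ f x) → 0# ≤ Σ⁺ f xs
  Σ⁺-nonNeg []       0≤f = ≤-refl
  Σ⁺-nonNeg (x ∷ xs) 0≤f = ≤-trans (Σ⁺-nonNeg xs 0≤f) (0≤⇒x≤y+x (0≤f x))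

  Π-nonNeg : {X : Set} {f : X → Carrier} (xs : List X) → (∀ x → 0# ≤ f x) → 0# ≤ Π f xs
  Π-nonNeg []       0≤f = proj₁ 0<1
  Π-nonNeg (x ∷ xs) 0≤f = *-nonNeg (0≤f x) (Π-nonNeg xs 0≤f)

  Σ⁺-1≉0 : {X : Set} (xs : List X) → ∃ (_∈ xs) → Σ⁺ (const 1#) xs ≉ 0#
  Σ⁺-1≉0 (x ∷ xs) _ ≈0 = <⇒≱ 0<1 (begin
    1#                        ≤⟨ 0≤⇒x≤y+x (Σ⁺-nonNeg xs (λ _ → proj₁ 0<1)) ⟩
    Σ⁺ (const 1#) xs + 1#     ≈⟨ +-comm _ 1# ⟩
    Σ⁺ (const 1#) (x ∷ xs)    ≈⟨ ≈0 ⟩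
    0#                        ∎)

  *-cancel-1 : ∀ {c x} → c ≉ 0# → c * x ≈ c → x ≈ 1#
  *-cancel-1 {c} {x} c≉0 cx≈c = begin-equality
    x              ≈⟨ *-identityˡ x ⟨
    1# * x         ≈⟨ *-congʳ (*-inverse c c≉0) ⟨
    (c * c ⁻¹) * x ≈⟨ *-congʳ (*-comm c _) ⟩
    (c ⁻¹ * c) * x ≈⟨ *-assoc _ c x ⟩
    c ⁻¹ * (c * x) ≈⟨ *-congˡ cx≈c ⟩
    c ⁻¹ * c       ≈⟨ *-comm _ c ⟩
    c * c ⁻¹       ≈⟨ *-inverse c c≉0 ⟩
    1#             ∎

  -- Sums over products of finite sets

  module _ {k} {B : Fin k → Set} where

    -- Without function extensionality, functions with equal values need not be equal; summands that
    -- respect pointwise equality make up for it.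
    Extensional : ((∀ i → B i) → Carrier) → Set
    Extensional h = ∀ {f g} → (∀ i → f i ≡ g i) → h f ≈ h g

  Σ⁺-choices : ∀ {k} {B : Fin (suc k) → Set} (L : ∀ i → List (B i)) {h : (∀ i → B i) → Carrier} →
    Extensional h →
    Σ⁺ h (choices L) ≈ Σ⁺ (λ b → Σ⁺ (λ f → h (cons b f)) (choices (L ∘ suc))) (L zero)
  Σ⁺-choices L {h} ext = trans (Σ⁺-cartesianProductWith h _ (L zero) _)
    (Σ⁺-cong (L zero) λ b → Σ⁺-cong (choices (L ∘ suc)) λ f → ext λ { zero → ≡.refl ; (suc i) → ≡.refl })

  -- The distributive law: expanding a product of sums picks one summand from each factor, and
  -- `choices` lists these selections.
  Σ⁺-choices-Π : ∀ {k} {B : Fin k → Set} (L : ∀ i → List (B i)) (g : ∀ i → B i → Carrier) →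
    Σ⁺ (λ f → Π (λ i → g i (f i)) (allFin k)) (choices L) ≈ Π (λ i → Σ⁺ (g i) (L i)) (allFin k)
  Σ⁺-choices-Π {zero}  L g = +-identityʳ 1#
  Σ⁺-choices-Π {suc k} {B} L g = begin-equality
    Σ⁺ (λ f → Π (λ i → g i (f i)) (allFin (suc k))) (choices L)
      ≈⟨ Σ⁺-choices L (λ eq → Π-cong (allFin (suc k)) (λ i → reflexive (cong (g i) (eq i)))) ⟩
    Σ⁺ (λ b → Σ⁺ (λ f → Π (λ i → g i (cons {B = B} b f i)) (allFin (suc k))) (choices (L ∘ suc))) (L zero)
      ≈⟨ Σ⁺-cong (L zero) (λ b → Σ⁺-cong (choices (L ∘ suc)) λ f →
           reflexive (Π-allFin (λ i → g i (cons {B = B} b f i)))) ⟩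
    Σ⁺ (λ b → Σ⁺ (λ f → g zero b * Π (λ i → g (suc i) (f i)) (allFin k)) (choices (L ∘ suc))) (L zero)
      ≈⟨ Σ⁺-cong (L zero) (λ b → Σ⁺-*ˡ (g zero b) _ (choices (L ∘ suc))) ⟩
    Σ⁺ (λ b → g zero b * Σ⁺ (λ f → Π (λ i → g (suc i) (f i)) (allFin k)) (choices (L ∘ suc))) (L zero)
      ≈⟨ Σ⁺-*ʳ _ (g zero) (L zero) ⟩
    Σ⁺ (g zero) (L zero) * Σ⁺ (λ f → Π (λ i → g (suc i) (f i)) (allFin k)) (choices (L ∘ suc))
      ≈⟨ *-congˡ (Σ⁺-choices-Π (L ∘ suc) (g ∘ suc)) ⟩
    Σ⁺ (g zero) (L zero) * Π (λ i → Σ⁺ (g (suc i)) (L (suc i))) (allFin k)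
      ≡⟨ Π-allFin (λ i → Σ⁺ (g i) (L i)) ⟨
    Π (λ i → Σ⁺ (g i) (L i)) (allFin (suc k)) ∎

  -- Overwriting coordinate `i` forgets its old value, so every function arises once for each
  -- possible old value.
  Σ⁺-update : ∀ {k} {B : Fin k → Set} (L : ∀ i → List (B i)) (i : Fin k) {h : (∀ i → B i) → Carrier} →
    Extensional h →
    Σ⁺ (λ f → Σ⁺ (λ x → h (update i x f)) (L i)) (choices L) ≈ Σ⁺ (const 1#) (L i) * Σ⁺ h (choices L)
  Σ⁺-update {suc k} L zero {h} ext = begin-equality
    Σ⁺ (λ f → Σ⁺ (λ x → h (update zero x f)) (L zero)) (choices L)
      ≈⟨ Σ⁺-choices L (λ eq → Σ⁺-cong (L zero) λ x → ext (update-cong zero x eq)) ⟩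
    Σ⁺ (λ b → Σ⁺ (λ f → Σ⁺ (λ x → h (update zero x (cons b f))) (L zero)) Fs) (L zero)
      ≈⟨ Σ⁺-cong (L zero) (λ b → Σ⁺-cong Fs λ f → Σ⁺-cong (L zero) λ x →
           ext λ { zero → ≡.refl ; (suc i) → ≡.refl }) ⟩
    Σ⁺ (const (Σ⁺ (λ f → Σ⁺ (λ x → h (cons x f)) (L zero)) Fs)) (L zero)
      ≈⟨ Σ⁺-const _ (L zero) ⟩
    Σ⁺ (const 1#) (L zero) * Σ⁺ (λ f → Σ⁺ (λ x → h (cons x f)) (L zero)) Fs
      ≈⟨ *-congˡ (Σ⁺-swap _ Fs (L zero)) ⟩
    Σ⁺ (const 1#) (L zero) * Σ⁺ (λ x → Σ⁺ (λ f → h (cons x f)) Fs) (L zero)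
      ≈⟨ *-congˡ (Σ⁺-choices L ext) ⟨
    Σ⁺ (const 1#) (L zero) * Σ⁺ h (choices L) ∎
    where Fs = choices (L ∘ suc)
  Σ⁺-update {suc k} L (suc i) {h} ext = begin-equality
    Σ⁺ (λ f → Σ⁺ (λ x → h (update (suc i) x f)) (L (suc i))) (choices L)
      ≈⟨ Σ⁺-choices L (λ eq → Σ⁺-cong (L (suc i)) λ x → ext (update-cong (suc i) x eq)) ⟩
    Σ⁺ (λ b → Σ⁺ (λ f → Σ⁺ (λ x → h (update (suc i) x (cons b f))) (L (suc i))) Fs) (L zero)
      ≈⟨ Σ⁺-cong (L zero) (λ b → Σ⁺-cong Fs λ f → Σ⁺-cong (L (suc i)) λ x →
           ext λ { zero → ≡.refl ; (suc i) → ≡.refl }) ⟩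
    Σ⁺ (λ b → Σ⁺ (λ f → Σ⁺ (λ x → h (cons b (update i x f))) (L (suc i))) Fs) (L zero)
      ≈⟨ Σ⁺-cong (L zero) (λ b → Σ⁺-update (L ∘ suc) i
           (λ eq → ext λ { zero → ≡.refl ; (suc i) → eq i })) ⟩
    Σ⁺ (λ b → Σ⁺ (const 1#) (L (suc i)) * Σ⁺ (λ f → h (cons b f)) Fs) (L zero)
      ≈⟨ Σ⁺-*ˡ _ _ (L zero) ⟩
    Σ⁺ (const 1#) (L (suc i)) * Σ⁺ (λ b → Σ⁺ (λ f → h (cons b f)) Fs) (L zero)
      ≈⟨ *-congˡ (Σ⁺-choices L ext) ⟨
    Σ⁺ (const 1#) (L (suc i)) * Σ⁺ h (choices L) ∎
    where Fs = choices (L ∘ suc)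

  -- After the overwriting of `Σ⁺-update`, `h` can be pulled out of the inner sum, and what remains
  -- there is 1.
  Σ⁺-integrate : ∀ {k} {B : Fin k → Set} (L : ∀ i → List (B i)) (i : Fin k) {h g : (∀ i → B i) → Carrier} →
    Extensional h → Extensional g → (∀ x f → h (update i x f) ≈ h f) →
    (∀ f → Σ⁺ (λ x → g (update i x f)) (L i) ≈ 1#) →
    Σ⁺ (const 1#) (L i) * Σ⁺ (λ f → h f * g f) (choices L) ≈ Σ⁺ h (choices L)
  Σ⁺-integrate L i {h} {g} h-ext g-ext indep total-1 = begin-equality
    Σ⁺ (const 1#) (L i) * Σ⁺ (λ f → h f * g f) (choices L)
      ≈⟨ Σ⁺-update L i (λ eq → *-cong (h-ext eq) (g-ext eq)) ⟨
    Σ⁺ (λ f → Σ⁺ (λ x → h (update i x f) * g (update i x f)) (L i)) (choices L)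
      ≈⟨ Σ⁺-cong (choices L) (λ f → Σ⁺-cong (L i) λ x → *-congʳ (indep x f)) ⟩
    Σ⁺ (λ f → Σ⁺ (λ x → h f * g (update i x f)) (L i)) (choices L)
      ≈⟨ Σ⁺-cong (choices L) (λ f → Σ⁺-*ˡ (h f) _ (L i)) ⟩
    Σ⁺ (λ f → h f * Σ⁺ (λ x → g (update i x f)) (L i)) (choices L)
      ≈⟨ Σ⁺-cong (choices L) (λ f → trans (*-congˡ (total-1 f)) (*-identityʳ (h f))) ⟩
    Σ⁺ h (choices L) ∎

  -- These are the weights of independent coin tosses, one per tuple. A relation of arity `suc k` is
  -- a family of relations of arity `k` indexed by the first entry, so the distributive law reduces
  -- the sum to a product of sums for arity `k`.
  Σ⁺-relations : ∀ N k (p : Vec (Fin N) k → Carrier) →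
    Σ⁺ (λ X → Π (λ a → if X a then p a else 1# - p a) (tuples N k)) (relations N k) ≈ 1#
  Σ⁺-relations N zero p = begin-equality
    (1# - p []) * 1# + (p [] * 1# + 0#) ≈⟨ +-cong (*-identityʳ _) (trans (+-identityʳ _) (*-identityʳ _)) ⟩
    (1# - p []) + p []                  ≈⟨ x-z+z≈x 1# (p []) ⟩
    1#                                  ∎
  Σ⁺-relations N (suc k) p = begin-equality
    Σ⁺ (λ X → Π (λ a → weight X a) (tuples N (suc k))) (relations N (suc k))
      ≡⟨ Σ⁺-map (λ X → Π (weight X) (tuples N (suc k))) _ (choices (λ (_ : Fin N) → relations N k)) ⟩
    -- The map inside `relations` is an anonymous pattern-matching function that cannot be written
    -- again, so this term is left to unification.
    _ ≈⟨ Σ⁺-cong (choices (λ (_ : Fin N) → relations N k)) (λ f →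
           Π-cartesianProductWith (weight _) (Vec._∷_ {n = k}) (allFin N) (tuples N k)) ⟩
    Σ⁺ (λ f → Π (λ a → Π (λ as → if f a as then p (a ∷ as) else 1# - p (a ∷ as)) (tuples N k)) (allFin N))
       (choices (λ (_ : Fin N) → relations N k))
      ≈⟨ Σ⁺-choices-Π (λ (_ : Fin N) → relations N k)
           (λ a X → Π (λ as → if X as then p (a ∷ as) else 1# - p (a ∷ as)) (tuples N k)) ⟩
    Π (λ a → Σ⁺ (λ X → Π (λ as → if X as then p (a ∷ as) else 1# - p (a ∷ as)) (tuples N k)) (relations N k))
      (allFin N)
      ≈⟨ Π-cong (allFin N) (λ a → Σ⁺-relations N k (λ as → p (a ∷ as))) ⟩
    Π (const 1#) (allFin N)
      ≈⟨ Π-1 (allFin N) ⟩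
    1# ∎
    where
    weight : (Vec (Fin N) (suc k) → Bool) → Vec (Fin N) (suc k) → Carrier
    weight X a = if X a then p a else 1# - p a

-- Values of formulas under pointwise equality of structures.

module Probability (em : ExcludedMiddle 0ℓ) (ℝ : CompleteOrderedField) where
  open Theory em ℝ
  open CompleteOrderedField ℝ hiding (zero)
  open OrderedField ℝ
  open Algebra.Properties.AbelianGroup +-abelianGroup using ()
    renaming (⁻¹-anti-homo‿- to -‿anti-homo‿-; x≈y⇒x∙y⁻¹≈ε to x≈y⇒x-y≈0)
  open Algebra.Properties.CommutativeSemigroup *-commutativeSemigroup using ()
    renaming (x∙yz≈xz∙y to x*yz≈xz*y; xy∙z≈y∙xz to xy*z≈y*xz)
  open ≤-Reasoning

  -- Together with its converse, this extracts compatibility with `_≈_` from continuity.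
  ∣x-y∣<ε⇒x≈y : ∀ {x y} → (∀ ε → 0# < ε → ∣ x - y ∣ < ε) → x ≈ y
  ∣x-y∣<ε⇒x≈y {x} {y} close with em {x ≈ y}
  ... | yes x≈y = x≈y
  ... | no  x≉y with total x y
  ...   | inj₁ x≤y = contradiction
    (≤-trans (≤-reflexive (sym (-‿anti-homo‿- x y))) (-x≤∣x∣ (x - y)))
    (<⇒≱ (close (y - x) (x<y⇒0<y-x (x≤y , x≉y))))
  ...   | inj₂ y≤x = contradiction (x≤∣x∣ (x - y)) (<⇒≱ (close (x - y) (x<y⇒0<y-x (y≤x , x≉y ∘ sym))))

  x≈y⇒∣x-y∣<ε : ∀ {x y ε} → x ≈ y → 0# < ε → ∣ x - y ∣ < ε
  x≈y⇒∣x-y∣<ε {x} {y} {ε} x≈y 0<ε =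
    ∣x∣<ε (begin-strict x - y ≈⟨ x≈y⇒x-y≈0 x≈y ⟩ 0# <⟨ 0<ε ⟩ ε ∎)
          (begin-strict - (x - y) ≈⟨ -‿anti-homo‿- x y ⟩ y - x ≈⟨ x≈y⇒x-y≈0 (sym x≈y) ⟩ 0# <⟨ 0<ε ⟩ ε ∎)

  ≮⇒≥ : ∀ {x y} → ¬ (x < y) → y ≤ x
  ≮⇒≥ = ToStrict.≮⇒≥ _≈_ _≤_ sym (λ _ _ → em) ≤-reflexive total

  evalAtom-cong : ∀ {σ N n} {A B : Structure σ N} → (∀ R → A R ≡ B R) →
                  (a : Vec (Fin N) n) (α : Atom σ n) → evalAtom A a α ≡ evalAtom B a α
  evalAtom-cong eq a (x ≐ y)    = ≡.refl
  evalAtom-cong eq a (rel R xs) = cong (_$ _) (eq R)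

  -- Connectives and aggregation functions are not assumed to respect equality of reals. For the
  -- former it follows from continuity, since equal arguments are within every δ; for the latter
  -- from symmetry, since pointwise equal sequences are permutations of each other.
  value-cong : ∀ {σ N n} {A B : Structure σ N} → (∀ R → A R ≡ B R) →
               (φ : coPLA⁺ σ n) (a : Vec (Fin N) n) → val (value A φ a) ≈ val (value B φ a)
  value-cong eq (real c)   a = refl
  value-cong eq (atom α)   a = reflexive (cong (λ b → val (if b then 𝟙 else 𝟘)) (evalAtom-cong eq a α))
  value-cong eq (conn C φ) a = ∣x-y∣<ε⇒x≈y λ ε 0<ε →
    let δ , 0<δ , close = Connective.continuous C _ ε 0<ε
    in close _ λ i → x≈y⇒∣x-y∣<ε (value-cong eq (φ i) a) 0<δ
  -- The range of aggregation is cut out by an ∅-type, so it is the same list for both structures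
  -- and one case split serves both.
  value-cong {N = N} eq (agg m F φ p) a
    with List.filterᵇ (λ b → evalLiterals ∅-structure (a ++ b) (literals p)) (tuples N m)
  ... | []     = refl
  ... | b ∷ bs = StronglyAdmissible.symmetric F _ _ λ i →
    Permutation.refl (Pointwise.map⁺ _ _
      (Pointwise.refl (λ {b} → value-cong eq (φ i) (a ++ b)) {b ∷ bs}))

  if-cong : ∀ b {x y} → x ≈ y → (if b then x else 1# - x) ≈ (if b then y else 1# - y)
  if-cong true  x≈y = x≈y
  if-cong false x≈y = +-congˡ (-‿cong x≈y)

  if-nonNeg : ∀ b {x} → 0# ≤ x → x ≤ 1# → 0# ≤ (if b then x else 1# - x)
  if-nonNeg true  0≤x x≤1 = 0≤x
  if-nonNeg false 0≤x x≤1 = x≤y⇒0≤y-x x≤1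

  -- Finite measures given by nonnegative weights.

  module Measure {X : Set} (w : X → Carrier) (w≥0 : ∀ x → 0# ≤ w x) where

    -- For the weights of a network and the list of all structures, this is `ℙ` by definition.
    measure : Pred X 0ℓ → List X → Carrier
    measure E xs = Σ⁺ w (filter (λ x → em {E x}) xs)

    private
      part : Pred X 0ℓ → X → Carrier
      part E x = if does (em {E x}) then w x else 0#

      -- Replaces filtering by an indicator, so that sums for different events run over the same
      -- list and can be compared term by term.
      measure-part : (E : Pred X 0ℓ) (xs : List X) → measure E xs ≈ Σ⁺ (part E) xs
      measure-part E []       = refl
      measure-part E (x ∷ xs) with does (em {E x})
      ... | true  = +-congˡ (measure-part E xs)
      ... | false = trans (measure-part E xs) (sym (+-identityˡ _))

      part-∪ : {E F H : Pred X 0ℓ} → (∀ {x} → H x → E x ⊎ F x) → ∀ x → part H x ≤ part E x + part F x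
      part-∪ {E} {F} {H} H⊆E∪F x with em {H x} | em {E x} | em {F x}
      ... | yes h | no ¬e | no ¬f = contradiction (H⊆E∪F h) [ ¬e , ¬f ]′
      ... | yes _ | yes _ | yes _ = 0≤⇒x≤y+x (w≥0 x)
      ... | yes _ | yes _ | no  _ = ≤-reflexive (sym (+-identityʳ _))
      ... | yes _ | no  _ | yes _ = ≤-reflexive (sym (+-identityˡ _))
      ... | no  _ | yes _ | yes _ = ≤-trans (w≥0 x) (0≤⇒x≤y+x (w≥0 x))
      ... | no  _ | yes _ | no  _ = ≤-trans (w≥0 x) (≤-reflexive (sym (+-identityʳ _)))
      ... | no  _ | no  _ | yes _ = ≤-trans (w≥0 x) (0≤⇒x≤y+x ≤-refl)
      ... | no  _ | no  _ | no  _ = 0≤⇒x≤y+x ≤-refl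

    measure-∪ : {E F H : Pred X 0ℓ} (xs : List X) → (∀ {x} → H x → E x ⊎ F x) →
                measure H xs ≤ measure E xs + measure F xs
    measure-∪ {E} {F} {H} xs H⊆E∪F = begin
      measure H xs                        ≈⟨ measure-part H xs ⟩
      Σ⁺ (part H) xs                      ≤⟨ Σ⁺-mono xs (part-∪ H⊆E∪F) ⟩
      Σ⁺ (λ x → part E x + part F x) xs   ≈⟨ Σ⁺-+ _ _ xs ⟩
      Σ⁺ (part E) xs + Σ⁺ (part F) xs     ≈⟨ +-cong (measure-part E xs) (measure-part F xs) ⟨
      measure E xs + measure F xs         ∎

    measure-nonNeg : (E : Pred X 0ℓ) (xs : List X) → 0# ≤ measure E xs
    measure-nonNeg E xs = Σ⁺-nonNeg (filter (λ x → em {E x}) xs) w≥0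

    measure-all : {E : Pred X 0ℓ} (xs : List X) → (∀ x → E x) → measure E xs ≡ Σ⁺ w xs
    measure-all xs all = cong (Σ⁺ w) (filter-all (λ x → em) (All.universal all xs))

    measure-none : {E : Pred X 0ℓ} (xs : List X) → (∀ x → ¬ E x) → measure E xs ≡ 0#
    measure-none xs none = cong (Σ⁺ w) (filter-none (λ x → em) (All.universal none xs))

    measure≤total : (E : Pred X 0ℓ) (xs : List X) → measure E xs ≤ Σ⁺ w xs
    measure≤total E xs = ≤-trans (≤-reflexive (measure-part E xs)) (Σ⁺-mono xs part≤w)
      where
      part≤w : ∀ x → part E x ≤ w x
      part≤w x with does (em {E x})
      ... | true  = ≤-refl
      ... | false = w≥0 x

  -- Maxima, proportions, and types as formulas.

  x≤foldr-⊔ : ∀ {x xs} → x ∈ xs → x ℕ.≤ List.foldr ℕ._⊔_ 0 xs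
  x≤foldr-⊔ {xs = y ∷ xs} (here ≡.refl) = ℕ.m≤m⊔n y _
  x≤foldr-⊔ {xs = y ∷ xs} (there x∈xs)  = ℕ.≤-trans (x≤foldr-⊔ x∈xs) (ℕ.m≤n⊔m y _)

  proportion-cong : ∀ {N m} {P Q Q′ : Pred (Vec (Fin N) m) 0ℓ} → (∀ b → Q b → Q′ b) → (∀ b → Q′ b → Q b) →
                    proportion P Q ≡ proportion P Q′
  proportion-cong {N} {m} {P} {Q} {Q′} Q⊆Q′ Q′⊆Q = ≡.cong₂ (λ k l → fromℕ k * fromℕ l ⁻¹)
    (cong List.length (filter-≐ (λ b → em {P b × Q b}) (λ b → em {P b × Q′ b})
      ((λ { (p , q) → p , Q⊆Q′ _ q }) , (λ { (p , q) → p , Q′⊆Q _ q })) (tuples N m)))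
    (cong List.length (filter-≐ (λ b → em {Q b}) (λ b → em {Q′ b}) (Q⊆Q′ _ , Q′⊆Q _) (tuples N m)))

  evalAtom-weaken : ∀ {σ N n m} (A : Structure σ N) (a : Vec (Fin N) n) (b : Vec (Fin N) m) α →
                    evalAtom A (a ++ b) (weakenAtom m α) ≡ evalAtom A a α
  evalAtom-weaken A a b (x ≐ y)    =
    ≡.cong₂ (λ x y → does (x Fin.≟ y)) (Vec.lookup-++ˡ a b x) (Vec.lookup-++ˡ a b y)
  evalAtom-weaken A a b (rel R xs) = cong (A R)
    (≡.trans (≡.sym (Vec.map-∘ _ _ xs)) (Vec.map-cong (Vec.lookup-++ˡ a b) xs))

  -- Stated for an arbitrary translation `f` of literals, because the one in `⋀` is local and can
  -- only be found by unification.
  ⊨-conjunction : ∀ {σ N n k} {A : Structure σ N} {a : Vec (Fin N) n} {c : Vec (Fin N) k}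
    (f : Literal σ n → CPL σ k) → (∀ l → T (evalLiteral A a l) → A ⊨ f l [ c ]) →
    ∀ ls → T (evalLiterals A a ls) → A ⊨ List.foldr _∧̇_ ⊤̇ (map f ls) [ c ]
  ⊨-conjunction f sound []       _     = tt
  ⊨-conjunction f sound (l ∷ ls) holds with h , hs ← to T-∧ holds =
    sound l h , ⊨-conjunction f sound ls hs

  ⊨⋀ : ∀ {σ N n m} {A : Structure σ N} {a : Vec (Fin N) n} (q : AtomicType σ n) (b : Vec (Fin N) m) →
       T (evalLiterals A a (literals q)) → A ⊨ ⋀ m q [ a ++ b ]
  ⊨⋀ {A = A} {a} q b = ⊨-conjunction _
    (λ { (pos α) holds → subst T (≡.sym (evalAtom-weaken A a b α)) holds
       ; (neg α) holds holds′ → T-not⇒¬T holds (subst T (evalAtom-weaken A a b α) holds′) })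
    (literals q)

  module _ {σ : Signature} (G : Network σ) where
    open Network G hiding (ℙ)

    private
      Edge : Symbol σ → Symbol σ → Set
      Edge Q R = Q ∈ˢ par R

    -- Total mass

    -- Numbered backwards: 0 is the endpoint and larger numbers lie further upstream, which explains
    -- the reversed pair in `vertex⁺`.
    vertex : ∀ {l R} → PathTo l R → Fin (suc l) → Symbol σ
    vertex {R = R}     path           zero    = R
    vertex {l = suc l} (_ , _ , path) (suc i) = vertex path i

    vertex⁺ : ∀ {l R} (path : PathTo l R) {i j} → i Fin.< j →
              TransClosure Edge (vertex path j) (vertex path i)
    vertex⁺ {suc l} (_ , Q→R , path) {zero}  {suc zero}    _         = [ Q→R ]
    vertex⁺ {suc l} (_ , Q→R , path) {zero}  {suc (suc j)} _         = vertex⁺ path {zero} {suc j} (s≤s z≤n) ∷ʳ Q→R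
    vertex⁺ {suc l} (_ , Q→R , path) {suc i} {suc j}       (s≤s i<j) = vertex⁺ path i<j

    -- A path with `l` edges visits `suc l` vertices. If these outnumber the symbols, one is
    -- repeated, and the stretch in between is a cycle. So the bound `size σ` in `mp` cuts off no
    -- path.
    path-length : ∀ {l R} → PathTo l R → l ℕ.< size σ
    path-length {l} path with suc l ℕ.≤? size σ
    ... | yes l<size = l<size
    ... | no  l≮size
      with i , j , i<j , eq ← Fin.pigeonhole (ℕ.≰⇒> l≮size) (vertex path) =
        contradiction (subst (TransClosure Edge _) eq (vertex⁺ path i<j)) (acyclic _)

    path≤mp : ∀ {l R} → PathTo l R → l ℕ.≤ mp R
    path≤mp {l} {R} path =
      x≤foldr-⊔ (∈-filter⁺ (λ l → em {PathTo l R}) (∈-upTo⁺ (path-length path)) path)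

    mp-path : ∀ R → PathTo (mp R) R
    mp-path R with foldr-selective ℕ.⊔-sel 0 (filter (λ l → em {PathTo l R}) (List.upTo (size σ)))
    -- The default value 0 of the maximum is attained by the path without edges.
    ... | inj₁ mp≡0 = subst (λ l → PathTo l R) (≡.sym mp≡0) tt
    ... | inj₂ mp∈  = proj₂ (∈-filter⁻ (λ l → em {PathTo l R}) {xs = List.upTo (size σ)} mp∈)

    -- A longest path to `Q` is prolonged by the edge to `R`. This is what makes decreasing `mp` a
    -- valid order of integration.
    parent-mp : ∀ {Q R} → Q ∈ˢ par R → mp Q ℕ.< mp R
    parent-mp {Q} Q→R = path≤mp (Q , Q→R , mp-path Q)

    mp≤ρ : ∀ R → mp R ℕ.≤ ρ
    mp≤ρ R = x≤foldr-⊔ (∈-map⁺ mp (∈-allFin R))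

    -- Separates the two roles of the structure: `X` is the interpretation being weighted, while `B`
    -- supplies the parents. In `factor-total`, `X` varies and `B` stays fixed.
    factor-expand : ∀ {N} {A B : Structure σ N} R {X} → A R ≡ X → (∀ Q → Q ∈ˢ par R → A Q ≡ B Q) →
      factor A R ≈ Π (λ a → let p = val (value (reduct (par R) B) (θ R) a) in if X a then p else 1# - p)
                     (tuples N (arity σ R))
    factor-expand {N} {A} R ≡.refl eq = Π-cong (tuples N (arity σ R)) λ a →
      if-cong (A R a) (value-cong (λ Q → eq _ (embed-∈ (par R) Q)) (θ R) a)

    factor-cong : ∀ {N} {A B : Structure σ N} R → A R ≡ B R → (∀ Q → Q ∈ˢ par R → A Q ≡ B Q) →
                  factor A R ≈ factor B R
    factor-cong {B = B} R eq eqs =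
      trans (factor-expand R eq eqs) (sym (factor-expand {A = B} R ≡.refl (λ _ _ → ≡.refl)))

    factor-nonNeg : ∀ {N} (A : Structure σ N) R → 0# ≤ factor A R
    factor-nonNeg {N} A R = Π-nonNeg (tuples N (arity σ R)) λ a →
      let v = value (reduct (par R) A) (θ R) a in if-nonNeg (A R a) (0≤ v) (≤1 v)

    -- By acyclicity `R` is not its own parent, so updating it leaves the probabilities unchanged
    -- and `Σ⁺-relations` applies.
    factor-total : ∀ {N} (A : Structure σ N) R →
                   Σ⁺ (λ X → factor (update R X A) R) (relations N (arity σ R)) ≈ 1#
    factor-total {N} A R = trans
      (Σ⁺-cong (relations N (arity σ R)) λ X → factor-expand R (update-same R X A) λ Q Q→R →
        update-other R X A λ { ≡.refl → acyclic R [ Q→R ] })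
      (Σ⁺-relations N (arity σ R) _)

    private
      layer : ℕ → List (Symbol σ)
      layer r = filter (λ R → mp R ℕ.≟ r) (allFin (size σ))

    -- `level r` collects the factors of the symbols with `mp` below `r`, and their parents have
    -- smaller `mp` still.
    level-cong : ∀ {N} r {A B : Structure σ N} → (∀ Q → mp Q ℕ.< r → A Q ≡ B Q) →
                 level r A ≈ level r B
    level-cong zero    eq = refl
    level-cong (suc r) eq = *-cong (level-cong r λ Q mp<r → eq Q (ℕ.m<n⇒m<1+n mp<r))
      (Π-cong-All (All.map (λ { {R} ≡.refl → factor-cong R (eq R ℕ.≤-refl)
                                  λ Q Q→R → eq Q (ℕ.m<n⇒m<1+n (parent-mp Q→R)) })
                           (all-filter (λ R → mp R ℕ.≟ r) (allFin (size σ)))))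

    level-nonNeg : ∀ {N} r (A : Structure σ N) → 0# ≤ level r A
    level-nonNeg zero    A = proj₁ 0<1
    level-nonNeg (suc r) A = *-nonNeg (level-nonNeg r A) (Π-nonNeg (layer r) (factor-nonNeg A))

    module _ (N : ℕ) where
      private
        c : Symbol σ → Carrier
        c R = Σ⁺ (const 1#) (relations N (arity σ R))

        layers : ℕ → Carrier
        layers zero    = 1#
        layers (suc r) = layers r * Π c (layer r)

        layers-Π : ∀ r → layers r ≈ Π c (filter (λ R → mp R ℕ.<? r) (allFin (size σ)))
        layers-Π zero    = reflexive (cong (Π c)
          (≡.sym (filter-none (λ R → mp R ℕ.<? 0) (All.universal (λ _ ()) (allFin (size σ))))))
        layers-Π (suc r) = trans (*-congʳ (layers-Π r)) (sym
          (Π-filter-⊎ (λ R → mp R ℕ.<? r) (λ R → mp R ℕ.≟ r) (λ R → mp R ℕ.<? suc r)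
             ℕ.m<n⇒m<1+n (λ { ≡.refl → ℕ.≤-refl }) ℕ.m<1+n⇒m<n∨m≡n ℕ.<⇒≢ c (allFin (size σ))))

        -- Symbols are removed one at a time. No two symbols of a layer are joined by an edge and
        -- `level r` reads only lower layers, so by uniqueness nothing but the factor of `R` changes
        -- with `R`.
        integrate-layer : ∀ r (Rs : List (Symbol σ)) → Unique Rs → All (λ R → mp R ≡ r) Rs →
          Π c Rs * Σ⁺ (λ A → level r A * Π (factor A) Rs) (structures σ N) ≈ Σ⁺ (level r) (structures σ N)
        integrate-layer r []       _              _            =
          trans (*-identityˡ _) (Σ⁺-cong (structures σ N) λ A → *-identityʳ _)
        integrate-layer r (R ∷ Rs) (R∉Rs ∷ uniq) (mpR≡r ∷ mp≡r) = begin-equality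
          (c R * Π c Rs) * Σ⁺ (λ A → level r A * (factor A R * Π (factor A) Rs)) (structures σ N)
            ≈⟨ *-congˡ (Σ⁺-cong (structures σ N) λ A → x*yz≈xz*y _ _ _) ⟩
          (c R * Π c Rs) * Σ⁺ (λ A → (level r A * Π (factor A) Rs) * factor A R) (structures σ N)
            ≈⟨ xy*z≈y*xz _ _ _ ⟩
          Π c Rs * (c R * Σ⁺ (λ A → (level r A * Π (factor A) Rs) * factor A R) (structures σ N))
            ≈⟨ *-congˡ (Σ⁺-integrate (λ R → relations N (arity σ R)) R
                 (λ eq → rest-cong λ Q _ → eq Q)
                 (λ eq → factor-cong R (eq R) λ Q _ → eq Q)
                 (λ X A → rest-cong λ Q R≢Q → update-other R X A R≢Q)
                 (λ A → factor-total A R)) ⟩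
          Π c Rs * Σ⁺ (λ A → level r A * Π (factor A) Rs) (structures σ N)
            ≈⟨ integrate-layer r Rs uniq mp≡r ⟩
          Σ⁺ (level r) (structures σ N) ∎
          where
          below : ∀ {Q S} → mp Q ℕ.< mp S → mp S ≡ r → R ≢ Q
          below mpQ<mpS mpS≡r ≡.refl = ℕ.<⇒≢ mpQ<mpS (≡.trans mpR≡r (≡.sym mpS≡r))

          rest-cong : {A B : Structure σ N} → (∀ Q → R ≢ Q → A Q ≡ B Q) →
                      level r A * Π (factor A) Rs ≈ level r B * Π (factor B) Rs
          rest-cong eq = *-cong
            (level-cong r λ Q mpQ<r → eq Q λ { ≡.refl → ℕ.<⇒≢ mpQ<r mpR≡r })
            (Π-cong-All (All.zipWith (λ { {S} (R≢S , mpS≡r) →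
               factor-cong S (eq S R≢S) λ Q Q→S → eq Q (below (parent-mp Q→S) mpS≡r) })
               (R∉Rs , mp≡r)))

        layers-level : ∀ r → layers r * Σ⁺ (level r) (structures σ N) ≈ Σ⁺ (const 1#) (structures σ N)
        layers-level zero    = *-identityˡ _
        layers-level (suc r) = begin-equality
          (layers r * Π c (layer r)) * Σ⁺ (level (suc r)) (structures σ N)
            ≈⟨ *-assoc _ _ _ ⟩
          layers r * (Π c (layer r) * Σ⁺ (level (suc r)) (structures σ N))
            ≈⟨ *-congˡ (integrate-layer r (layer r)
                 (Unique.filter⁺ (λ R → mp R ℕ.≟ r) (Unique.allFin⁺ (size σ)))
                 (all-filter (λ R → mp R ℕ.≟ r) (allFin (size σ)))) ⟩
          layers r * Σ⁺ (level r) (structures σ N)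
            ≈⟨ layers-level r ⟩
          Σ⁺ (const 1#) (structures σ N) ∎

        -- As `ρ` bounds every `mp`, all symbols are counted; the distributive law with all weights
        -- 1 turns the product of the counts into the number of structures.
        layers-total : layers (suc ρ) ≈ Σ⁺ (const 1#) (structures σ N)
        layers-total = begin-equality
          layers (suc ρ)
            ≈⟨ layers-Π (suc ρ) ⟩
          Π c (filter (λ R → mp R ℕ.<? suc ρ) (allFin (size σ)))
            ≡⟨ cong (Π c) (filter-all (λ R → mp R ℕ.<? suc ρ)
                 (All.universal (λ R → s≤s (mp≤ρ R)) (allFin (size σ)))) ⟩
          Π c (allFin (size σ))
            ≈⟨ Σ⁺-choices-Π (λ R → relations N (arity σ R)) (λ _ _ → 1#) ⟨
          Σ⁺ (λ _ → Π (const 1#) (allFin (size σ))) (structures σ N)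
            ≈⟨ Σ⁺-cong (structures σ N) (λ _ → Π-1 (allFin (size σ))) ⟩
          Σ⁺ (const 1#) (structures σ N) ∎

      total-mass : Σ⁺ weightOf (structures σ N) ≈ 1#
      total-mass = *-cancel-1
        (Σ⁺-1≉0 (structures σ N) (choices-inhabited _ λ R → relations-inhabited N (arity σ R)))
        (trans (*-congʳ (sym layers-total)) (layers-level (suc ρ)))

    -- Negligible events

    Event : Set₁
    Event = ∀ N → Pred (Structure σ N) 0ℓ

    -- A record, so that E can be inferred from Negligible E.
    record Negligible (E : Event) : Set where
      constructor negligible
      field limit : Limit (λ N → ℙ G N (E N)) 0#

    private
      open module M {N} = Measure (weightOf {N}) (level-nonNeg (suc ρ))

    private
      null⇒< : ∀ {x ε} → ∣ x - 0# ∣ᵣ < ε → x < ε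
      null⇒< {x} {ε} ∣x-0∣<ε = begin-strict
        x            ≈⟨ x-0≈x x ⟨
        x - 0#       ≤⟨ x≤∣x∣ (x - 0#) ⟩
        ∣ x - 0# ∣   <⟨ ∣x-0∣<ε ⟩
        ε            ∎

      <⇒null : ∀ {x ε} → 0# ≤ x → x < ε → ∣ x - 0# ∣ᵣ < ε
      <⇒null {x} {ε} 0≤x x<ε = begin-strict
        ∣ x - 0# ∣   ≈⟨ 0≤⇒∣x∣≈x (x≤y⇒0≤y-x 0≤x) ⟩
        x - 0#       ≈⟨ x-0≈x x ⟩
        x            <⟨ x<ε ⟩
        ε            ∎

    -- The covering is asked for on nonempty domains only, since consistency of types and the models
    -- in `SafeConditional` refer to these. The `suc` in the threshold skips size 0.
    negligible-∪ : {E F H : Event} → (∀ {N A} → H (suc N) A → E (suc N) A ⊎ F (suc N) A) →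
                   Negligible E → Negligible F → Negligible H
    negligible-∪ {E} {F} {H} H⊆E∪F (negligible E-null) (negligible F-null) = negligible bound
      where
      bound : Limit (λ N → ℙ G N (H N)) 0#
      bound ε 0<ε
        with δ , 0<δ , δ+δ≈ε ← halve 0<ε
        with N₁ , E<δ ← E-null δ 0<δ | N₂ , F<δ ← F-null δ 0<δ =
        suc (N₁ ℕ.⊔ N₂) , λ { (suc N) (s≤s N₁⊔N₂≤N) →
          <⇒null (measure-nonNeg (H (suc N)) (structures σ (suc N))) (begin-strict
            ℙ G (suc N) (H (suc N))
              ≤⟨ measure-∪ (structures σ (suc N)) H⊆E∪F ⟩
            ℙ G (suc N) (E (suc N)) + ℙ G (suc N) (F (suc N))
              <⟨ +-mono-< (null⇒< (E<δ (suc N) (ℕ.m≤n⇒m≤1+n (ℕ.m⊔n≤o⇒m≤o N₁ N₂ N₁⊔N₂≤N))))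
                          (null⇒< (F<δ (suc N) (ℕ.m≤n⇒m≤1+n (ℕ.m⊔n≤o⇒n≤o N₁ N₂ N₁⊔N₂≤N)))) ⟩
            δ + δ
              ≈⟨ δ+δ≈ε ⟩
            ε ∎) }

    negligible-∅ : {E : Event} → (∀ {N A} → ¬ E (suc N) A) → Negligible E
    negligible-∅ {E} empty = negligible λ ε 0<ε → 1 , λ { (suc N) _ →
      <⇒null (measure-nonNeg (E (suc N)) (structures σ (suc N)))
        (≤-<-trans (≤-reflexive (reflexive (measure-none (structures σ (suc N)) λ _ → empty))) 0<ε) }

    -- The total mass 1 bounds `F` from above. From below, `E` and `F` cover all structures, so `F`
    -- misses at most the mass of `E`.
    negligible-complement : {E F : Event} → (∀ {N} A → E N A ⊎ F N A) → Negligible E →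
                            Limit (λ N → ℙ G N (F N)) 1#
    negligible-complement {E} {F} E∪F (negligible E-null) ε 0<ε with N₀ , E<ε ← E-null ε 0<ε =
      N₀ , λ N N₀≤N → let e = ℙ G N (E N) ; f = ℙ G N (F N) in ∣x∣<ε
        (begin-strict
          f - 1#       ≤⟨ +-monoˡ-≤ (- 1#) (measure≤total (F N) (structures σ N)) ⟩
          _ - 1#       ≈⟨ x≈y⇒x-y≈0 (total-mass N) ⟩
          0#           <⟨ 0<ε ⟩
          ε            ∎)
        (begin-strict
          - (f - 1#)   ≈⟨ -‿anti-homo‿- f 1# ⟩
          1# - f       ≈⟨ +-congʳ (total-mass N) ⟨
          _ - f        ≡⟨ cong (_- f) (measure-all (structures σ N) E∪F) ⟨
          _ - f        ≤⟨ +-monoˡ-≤ (- f) (measure-∪ (structures σ N) id) ⟩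
          (e + f) - f  ≈⟨ x+z-z≈x e f ⟩
          e            <⟨ null⇒< (E<ε N N₀≤N) ⟩
          ε            ∎)

    -- From answers on complete types to one quantifier-free formula.

    Disagree : ∀ {n} → List (Literal σ n) → CPL σ n → CPL σ n → Event
    Disagree P φ ψ N A = ∃ λ a → T (evalLiterals A a P) × ¬ ((A ⊨ φ [ a ]) ⇔ (A ⊨ ψ [ a ]))

    -- `P` ranges from `[]`, which admits every tuple, to the literals of a complete type.
    AlmostSurelyQF : ∀ {n} → CPL σ n → List (Literal σ n) → Set
    AlmostSurelyQF φ P = ∃ λ ψ → QuantifierFree ψ × Negligible (Disagree P φ ψ)

    module _ {n} (φ : CPL σ n)
             (on-types : (q : AtomicType σ n) → Complete q → AlmostSurelyQF φ (literals q)) where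

      private
        decided-∷ : ∀ {α : Atom σ n} {L P l} β → (β ≡ α → pos β ∈ l ∷ P ⊎ neg β ∈ l ∷ P) →
                    β ∈ α ∷ L ⊎ pos β ∈ P ⊎ neg β ∈ P → β ∈ L ⊎ pos β ∈ l ∷ P ⊎ neg β ∈ l ∷ P
        decided-∷ β new (inj₁ (here β≡α))  = inj₂ (new β≡α)
        decided-∷ β new (inj₁ (there β∈L)) = inj₁ β∈L
        decided-∷ β new (inj₂ (inj₁ β∈P))  = inj₂ (inj₁ (there β∈P))
        decided-∷ β new (inj₂ (inj₂ β∈P))  = inj₂ (inj₂ (there β∈P))

      -- A binary tree of decisions: `L` holds the atoms still open, and at a leaf `P` is complete.
      -- The formulas of the two branches are glued by a case distinction on `α`, so a disagreement
      -- of the result is one in a branch.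
      split-atoms : (L : List (Atom σ n)) (P : List (Literal σ n)) →
                    (∀ α → α ∈ L ⊎ pos α ∈ P ⊎ neg α ∈ P) → AlmostSurelyQF φ P
      split-atoms [] P decided with em {∃ λ N → Σ (Structure σ (suc N)) λ A → ∃ λ a → T (evalLiterals A a P)}
      ... | yes consistent = on-types (record { literals = P ; consistent = consistent })
                                      (λ α → [ (λ ()) , id ]′ (decided α))
      -- No tuple over a nonempty domain satisfies `P`, so any formula would do.
      ... | no  ¬consistent = ⊥̇ , ⊥̇ , negligible-∅ λ { (a , holds , _) → ¬consistent (_ , _ , a , holds) }
      split-atoms (α ∷ L) P decided
        with ψ₁ , qf₁ , null₁ ← split-atoms L (pos α ∷ P) (λ β → decided-∷ β (inj₁ ∘ here ∘ cong pos) (decided β))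
           | ψ₂ , qf₂ , null₂ ← split-atoms L (neg α ∷ P) (λ β → decided-∷ β (inj₂ ∘ here ∘ cong neg) (decided β)) =
        (atom α ∧̇ ψ₁) ∨̇ (¬̇ atom α ∧̇ ψ₂) , (atom α ∧̇ qf₁) ∨̇ (¬̇ atom α ∧̇ qf₂) ,
        negligible-∪ (λ { {A = A} (a , holds , disagree) → covered ψ₁ ψ₂ A a holds disagree }) null₁ null₂
        where
        covered : ∀ ψ₁ ψ₂ {N} (A : Structure σ N) a → T (evalLiterals A a P) →
          ¬ ((A ⊨ φ [ a ]) ⇔ (A ⊨ (atom α ∧̇ ψ₁) ∨̇ (¬̇ atom α ∧̇ ψ₂) [ a ])) →
          Disagree (pos α ∷ P) φ ψ₁ N A ⊎ Disagree (neg α ∷ P) φ ψ₂ N A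
        covered ψ₁ ψ₂ A a holds disagree with em {T (evalAtom A a α)}
        ... | yes t = inj₁ (a , from T-∧ (t , holds) , λ φ⇔ψ₁ → disagree
          (mk⇔ (λ x → inj₁ (t , to φ⇔ψ₁ x))
               [ from φ⇔ψ₁ ∘ proj₂ , (λ { (¬t , _) → contradiction t ¬t }) ]′))
        ... | no ¬t = inj₂ (a , from T-∧ (¬T⇒T-not ¬t , holds) , λ φ⇔ψ₂ → disagree
          (mk⇔ (λ x → inj₂ (¬t , to φ⇔ψ₂ x))
               [ (λ { (t , _) → contradiction t ¬t }) , from φ⇔ψ₂ ∘ proj₂ ]′))

      almostSurelyQF-types : AlmostSurelyQF φ []
      almostSurelyQF-types = split-atoms (atoms σ n) [] (inj₁ ∘ ∈-atoms)

    -- Conditionals on a complete type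

    Bad : ∀ {n m} → AtomicType σ n → (φ ψ : CPL σ (n ℕ.+ m)) → 𝕀 → Carrier →
          ∀ {N} → Structure σ N → Vec (Fin N) n → Set
    Bad {m = m} q φ ψ α ε A a =
      ¬ (∃ λ b → A ⊨ ψ ∧̇ ⋀ m q [ a ++ b ]) ⊎
      ε < ∣ val α - proportion (λ b → A ⊨ φ [ a ++ b ]) (λ b → A ⊨ ψ ∧̇ ⋀ m q [ a ++ b ]) ∣ᵣ

    -- By definition the event in `IsSaturationNumber`, so saturation says that it is negligible for
    -- every positive ε.
    SomeBad : ∀ {n m} → AtomicType σ n → (φ ψ : CPL σ (n ℕ.+ m)) → 𝕀 → Carrier → Event
    SomeBad q φ ψ α ε N A = ∃ λ a → T (evalLiterals A a (literals q)) × Bad q φ ψ α ε A a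

    saturated⇒negligible : ∀ {n m} (q : AtomicType σ n) (φ ψ : CPL σ (n ℕ.+ m)) α →
      IsSaturationNumber G q m φ (ψ ∧̇ ⋀ m q) α → ∀ {ε} → 0# < ε → Negligible (SomeBad q φ ψ α ε)
    saturated⇒negligible q φ ψ α saturated {ε} 0<ε = negligible (saturated ε 0<ε)

    -- On realisations of `q` the conjunct `⋀ m q` holds automatically, so conditioning on
    -- `ψ ∧̇ ⋀ m q` is conditioning on `ψ`.
    ¬Bad⇒Close : ∀ {n m} (q : AtomicType σ n) (φ ψ : CPL σ (n ℕ.+ m)) {α ε N} {A : Structure σ N} {a} →
      T (evalLiterals A a (literals q)) → ¬ Bad q φ ψ α ε A a →
      (∃ λ b → A ⊨ ψ [ a ++ b ]) ×
      Close ε (val α) (proportion (λ b → A ⊨ φ [ a ++ b ]) (λ b → A ⊨ ψ [ a ++ b ]))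
    ¬Bad⇒Close {m = m} q φ ψ {α} {ε} {A = A} {a} a⊨q ¬bad with em {∃ λ b → A ⊨ ψ ∧̇ ⋀ m q [ a ++ b ]}
    ... | no  empty         = contradiction (inj₁ empty) ¬bad
    ... | yes (b , b⊨ψ , _) = (b , b⊨ψ) ,
      subst (Close ε (val α))
            (proportion-cong {P = λ b → A ⊨ φ [ a ++ b ]} (λ b → proj₁) (λ b b⊨ψ → b⊨ψ , ⊨⋀ q b a⊨q))
            (∣x-y∣≤ε⇒Close (≮⇒≥ (¬bad ∘ inj₂)))

    -- Treats both forms of conditional at once: `r` is added by `upper` for `condˡ` and by `lower`
    -- for `condʳ`, the other map being the identity. Both maps are translations, so they preserve
    -- closeness.
    module _ {n m} (φ₁ ψ₁ φ₂ ψ₂ : CPL σ (n ℕ.+ m)) (r : Carrier) (lower upper : Carrier → Carrier)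
             (lower-close : ∀ {ε x y} → Close ε x y → Close ε (lower x) (lower y))
             (upper-close : ∀ {ε x y} → Close ε x y → Close ε (upper x) (upper y))
             (separate : ∀ {x y} → lower y ≈ upper x → r ≈ ∣ x - y ∣)
             (χ : CPL σ n)
             (⊨χ : ∀ {N} (A : Structure σ N) a → (A ⊨ χ [ a ]) ⇔
               ((∃ λ b → A ⊨ ψ₁ [ a ++ b ]) × (∃ λ b → A ⊨ ψ₂ [ a ++ b ]) ×
                lower (proportion (λ b → A ⊨ φ₂ [ a ++ b ]) (λ b → A ⊨ ψ₂ [ a ++ b ])) ≤
                upper (proportion (λ b → A ⊨ φ₁ [ a ++ b ]) (λ b → A ⊨ ψ₁ [ a ++ b ])))) where

      private
        Model : AtomicType σ n → Set
        Model q = ∃ λ N → Σ (Structure σ (suc N)) λ A → ∃ λ a → ∃₂ λ b b′ →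
          (A ⊨ ψ₁ [ a ++ b ]) × (A ⊨ ψ₂ [ a ++ b′ ]) × T (evalLiterals A a (literals q))

        Agrees : AtomicType σ n → CPL σ n → 𝕀 → 𝕀 → Carrier → Set
        Agrees q ψ α₁ α₂ ε = ∀ {N} {A : Structure σ N} {a} → T (evalLiterals A a (literals q)) →
          ¬ Bad q φ₁ ψ₁ α₁ ε A a → ¬ Bad q φ₂ ψ₂ α₂ ε A a → (A ⊨ χ [ a ]) ⇔ (A ⊨ ψ [ a ])

        agrees⇒negligible : ∀ q {ψ α₁ α₂ ε} → Agrees q ψ α₁ α₂ ε →
          Negligible (SomeBad q φ₁ ψ₁ α₁ ε) → Negligible (SomeBad q φ₂ ψ₂ α₂ ε) →
          Negligible (Disagree (literals q) χ ψ)
        agrees⇒negligible q {ψ} {α₁} {α₂} {ε} agrees null₁ null₂ = negligible-∪ covered null₁ null₂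
          where
          covered : ∀ {N} {A : Structure σ (suc N)} → Disagree (literals q) χ ψ (suc N) A →
            SomeBad q φ₁ ψ₁ α₁ ε (suc N) A ⊎ SomeBad q φ₂ ψ₂ α₂ ε (suc N) A
          covered {A = A} (a , a⊨q , disagree) with em {Bad q φ₁ ψ₁ α₁ ε A a} | em {Bad q φ₂ ψ₂ α₂ ε A a}
          ... | yes bad₁ | _        = inj₁ (a , a⊨q , bad₁)
          ... | no  _    | yes bad₂ = inj₂ (a , a⊨q , bad₂)
          ... | no ¬bad₁ | no ¬bad₂ = contradiction (agrees a⊨q ¬bad₁ ¬bad₂) disagree

        -- `χ` demands witnesses for `ψ₁` and `ψ₂`, so a realisation of `q` satisfying it would be a
        -- model.
        no-model : ∀ q → ¬ Model q → Negligible (Disagree (literals q) χ ⊥̇)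
        no-model q noModel = negligible-∅ λ { {A = A} (a , a⊨q , disagree) → disagree
          (mk⇔ (λ a⊨χ → let (b , b⊨ψ₁) , (b′ , b′⊨ψ₂) , _ = to (⊨χ A a) a⊨χ
                        in noModel (_ , A , a , b , b′ , b⊨ψ₁ , b′⊨ψ₂ , a⊨q))
               (λ ())) }

        always : ∀ q {α₁ α₂ ε} →
          (∀ {x y} → Close ε (lower (val α₂)) x → Close ε (upper (val α₁)) y → x ≤ y) → Agrees q ⊤̇ α₁ α₂ ε
        always q {α₁} {α₂} stable {A = A} {a} a⊨q ¬bad₁ ¬bad₂ =
          let ∃ψ₁ , close₁ = ¬Bad⇒Close q φ₁ ψ₁ {α₁} a⊨q ¬bad₁
              ∃ψ₂ , close₂ = ¬Bad⇒Close q φ₂ ψ₂ {α₂} a⊨q ¬bad₂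
          in mk⇔ (const tt) (const (from (⊨χ A a) (∃ψ₁ , ∃ψ₂ , stable (lower-close close₂) (upper-close close₁))))

        never : ∀ q {α₁ α₂ ε} →
          (∀ {x y} → Close ε (lower (val α₂)) x → Close ε (upper (val α₁)) y → ¬ (x ≤ y)) → Agrees q ⊥̇ α₁ α₂ ε
        never q {α₁} {α₂} stable {A = A} {a} a⊨q ¬bad₁ ¬bad₂ =
          let _ , close₁ = ¬Bad⇒Close q φ₁ ψ₁ {α₁} a⊨q ¬bad₁
              _ , close₂ = ¬Bad⇒Close q φ₂ ψ₂ {α₂} a⊨q ¬bad₂
          in mk⇔ (λ a⊨χ → stable (lower-close close₂) (upper-close close₁) (proj₂ (proj₂ (to (⊨χ A a) a⊨χ))))
                 (λ ())

        decide : ∀ q {α₁ α₂ ε} →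
          (∀ {x y} → Close ε (lower (val α₂)) x → Close ε (upper (val α₁)) y → x ≤ y) ⊎
          (∀ {x y} → Close ε (lower (val α₂)) x → Close ε (upper (val α₁)) y → ¬ (x ≤ y)) →
          Negligible (SomeBad q φ₁ ψ₁ α₁ ε) → Negligible (SomeBad q φ₂ ψ₂ α₂ ε) →
          AlmostSurelyQF χ (literals q)
        decide q {α₁} {α₂} (inj₁ stable) null₁ null₂ =
          ⊤̇ , ⊤̇ , agrees⇒negligible q {⊤̇} {α₁} {α₂} (always q {α₁} {α₂} stable) null₁ null₂
        decide q {α₁} {α₂} (inj₂ stable) null₁ null₂ =
          ⊥̇ , ⊥̇ , agrees⇒negligible q {⊥̇} {α₁} {α₂} (never q {α₁} {α₂} stable) null₁ null₂

      conditional-on-type : SafeConditional G r m φ₁ ψ₁ φ₂ ψ₂ →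
                            (q : AtomicType σ n) → Complete q → AlmostSurelyQF χ (literals q)
      conditional-on-type safe q complete = [ with-model , without-model ]′ (toSum em)
        where
        without-model : ¬ Model q → AlmostSurelyQF χ (literals q)
        without-model noModel = ⊥̇ , ⊥̇ , no-model q noModel

        with-model : Model q → AlmostSurelyQF χ (literals q)
        with-model model =
          let α₁ , α₂ , saturated₁ , saturated₂ , r≉ = safe q complete model
              -- Equality of the two sides at the saturation numbers would give
              -- `r ≈ ∣ val α₁ - val α₂ ∣`, which safety excludes.
              ε , 0<ε , verdict = ≤-stable {lower (val α₂)} {upper (val α₁)} (r≉ ∘ separate)
              null₁ = saturated⇒negligible q φ₁ ψ₁ α₁ saturated₁ 0<ε
              null₂ = saturated⇒negligible q φ₂ ψ₂ α₂ saturated₂ 0<ε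
          in decide q {α₁} {α₂} verdict null₁ null₂

    -- Induction on safe formulas.

    safe-immediate : ∀ {k n} {φ : CPL σ k} {ψ : CPL σ n} → Immediate φ ψ → Safe G ψ → Safe G φ
    safe-immediate φ<ψ safe = record
      { noQuantifiers    = λ χ⊑φ → Safe.noQuantifiers safe (⊑-step χ⊑φ φ<ψ)
      ; safeConditionalˡ = λ χ⊑φ → Safe.safeConditionalˡ safe (⊑-step χ⊑φ φ<ψ)
      ; safeConditionalʳ = λ χ⊑φ → Safe.safeConditionalʳ safe (⊑-step χ⊑φ φ<ψ)
      }

    module _ {n} (_∙_ : CPL σ n → CPL σ n → CPL σ n)
             (∙-qf : ∀ {φ ψ} → QuantifierFree φ → QuantifierFree ψ → QuantifierFree (φ ∙ ψ))
             (∙-⇔ : ∀ {N} (A : Structure σ N) a {φ φ′ ψ ψ′} →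
                    (A ⊨ φ [ a ]) ⇔ (A ⊨ φ′ [ a ]) → (A ⊨ ψ [ a ]) ⇔ (A ⊨ ψ′ [ a ]) →
                    (A ⊨ φ ∙ ψ [ a ]) ⇔ (A ⊨ φ′ ∙ ψ′ [ a ])) where

      -- Where both components agree with their replacements, so do the compounds; a disagreement
      -- therefore comes from a component at the same tuple.
      almostSurelyQF-∙ : ∀ φ ψ → AlmostSurelyQF φ [] → AlmostSurelyQF ψ [] → AlmostSurelyQF (φ ∙ ψ) []
      almostSurelyQF-∙ φ ψ (φ′ , qf₁ , null₁) (ψ′ , qf₂ , null₂) =
        φ′ ∙ ψ′ , ∙-qf qf₁ qf₂ , negligible-∪ covered null₁ null₂
        where
        covered : ∀ {N A} → Disagree [] (φ ∙ ψ) (φ′ ∙ ψ′) (suc N) A →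
                  Disagree [] φ φ′ (suc N) A ⊎ Disagree [] ψ ψ′ (suc N) A
        covered {A = A} (a , holds , disagree) with em {(A ⊨ φ [ a ]) ⇔ (A ⊨ φ′ [ a ])}
        ... | no  φ≢φ′ = inj₁ (a , holds , φ≢φ′)
        ... | yes φ⇔φ′ = inj₂ (a , holds , disagree ∘ ∙-⇔ A a φ⇔φ′)

    almostSurelyQF-self : ∀ {n} {φ : CPL σ n} → QuantifierFree φ → AlmostSurelyQF φ []
    almostSurelyQF-self qf = _ , qf , negligible-∅ λ { (_ , _ , disagree) → disagree (mk⇔ id id) }

    -- As `r` is nonnegative, the equation fixes the sign of `x - y` and thereby resolves the
    -- absolute value.
    separateʳ : ∀ {r x y} → 0# ≤ r → y + r ≈ x → r ≈ ∣ x - y ∣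
    separateʳ {r} {x} {y} 0≤r y+r≈x =
      trans (sym x-y≈r) (sym (0≤⇒∣x∣≈x (≤-trans 0≤r (≤-reflexive (sym x-y≈r)))))
      where
      x-y≈r : x - y ≈ r
      x-y≈r = begin-equality
        x - y       ≈⟨ +-congʳ y+r≈x ⟨
        (y + r) - y ≈⟨ +-congʳ (+-comm y r) ⟩
        (r + y) - y ≈⟨ x+z-z≈x r y ⟩
        r           ∎

    separateˡ : ∀ {r x y} → 0# ≤ r → y ≈ r + x → r ≈ ∣ x - y ∣
    separateˡ {r} {x} {y} 0≤r y≈r+x =
      trans (sym y-x≈r) (trans (sym (-‿anti-homo‿- x y)) (sym (≤0⇒∣x∣≈-x (begin
        x - y     ≈⟨ -‿anti-homo‿- y x ⟨
        - (y - x) ≈⟨ -‿cong y-x≈r ⟩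
        - r       ≤⟨ 0≤⇒-x≤0 0≤r ⟩
        0#        ∎))))
      where
      y-x≈r : y - x ≈ r
      y-x≈r = trans (+-congʳ y≈r+x) (x+z-z≈x r x)

    safe⇒almostSurelyQF : ∀ {n} (φ : CPL σ n) → Safe G φ → AlmostSurelyQF φ []
    safe⇒almostSurelyQF (atom α) safe = almostSurelyQF-self (atom α)
    safe⇒almostSurelyQF ⊤̇        safe = almostSurelyQF-self ⊤̇
    safe⇒almostSurelyQF ⊥̇        safe = almostSurelyQF-self ⊥̇
    safe⇒almostSurelyQF (¬̇ φ)    safe =
      -- Negation is passed as a binary connective that ignores its second argument.
      almostSurelyQF-∙ (λ φ _ → ¬̇ φ) (λ qf _ → ¬̇ qf) (λ _ _ eq _ → ¬-cong-⇔ eq) φ φ ih ih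
      where ih = safe⇒almostSurelyQF φ (safe-immediate ¬-sub safe)
    safe⇒almostSurelyQF (φ ∧̇ ψ)  safe = almostSurelyQF-∙ _∧̇_ _∧̇_ (λ _ _ eq₁ eq₂ → eq₁ ×-cong eq₂) φ ψ
      (safe⇒almostSurelyQF φ (safe-immediate ∧-subˡ safe)) (safe⇒almostSurelyQF ψ (safe-immediate ∧-subʳ safe))
    safe⇒almostSurelyQF (φ ∨̇ ψ)  safe = almostSurelyQF-∙ _∨̇_ _∨̇_ (λ _ _ eq₁ eq₂ → eq₁ ⊎-cong eq₂) φ ψ
      (safe⇒almostSurelyQF φ (safe-immediate ∨-subˡ safe)) (safe⇒almostSurelyQF ψ (safe-immediate ∨-subʳ safe))
    safe⇒almostSurelyQF (φ →̇ ψ)  safe = almostSurelyQF-∙ _→̇_ _→̇_ (λ _ _ → →-cong-⇔) φ ψ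
      (safe⇒almostSurelyQF φ (safe-immediate →-subˡ safe)) (safe⇒almostSurelyQF ψ (safe-immediate →-subʳ safe))
    safe⇒almostSurelyQF (φ ↔̇ ψ)  safe = almostSurelyQF-∙ _↔̇_ _↔̇_ (λ _ _ → Related-cong) φ ψ
      (safe⇒almostSurelyQF φ (safe-immediate ↔-subˡ safe)) (safe⇒almostSurelyQF ψ (safe-immediate ↔-subʳ safe))
    safe⇒almostSurelyQF (∃̇ φ)    safe = contradiction ⊑-refl (Safe.noQuantifiers safe)
    -- The recursion stops at a conditional: its saturation numbers control the proportions,
    -- whatever the components are.
    safe⇒almostSurelyQF χ@(condˡ r r≥0 m φ ψ θ τ) safe = almostSurelyQF-types χ
      (conditional-on-type φ ψ θ τ r id (r +_) id (Close-+ˡ r) (separateˡ r≥0) χ (λ _ _ → mk⇔ id id)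
        (Safe.safeConditionalˡ safe ⊑-refl))
    safe⇒almostSurelyQF χ@(condʳ r r≥0 m φ ψ θ τ) safe = almostSurelyQF-types χ
      (conditional-on-type φ ψ θ τ r (_+ r) id (Close-+ʳ r) id (separateʳ r≥0) χ (λ _ _ → mk⇔ id id)
        (Safe.safeConditionalʳ safe ⊑-refl))

    negligible⇒almostSurelyEquivalent : ∀ {n} (φ ψ : CPL σ n) → Negligible (Disagree [] φ ψ) →
                                        AlmostSurelyEquivalent G φ ψ
    negligible⇒almostSurelyEquivalent φ ψ = negligible-complement λ A → agree-or-not A
      where
      agree-or-not : ∀ {N} (A : Structure σ N) →
                     Disagree [] φ ψ N A ⊎ (∀ a → (A ⊨ φ [ a ]) ⇔ (A ⊨ ψ [ a ]))
      agree-or-not {N} A with em {Disagree [] φ ψ N A}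
      ... | yes disagree = inj₁ disagree
      ... | no  agree    = inj₂ λ a → decidable-stable em λ φ≢ψ → agree (a , tt , φ≢ψ)

theorem8p6 : (em : ExcludedMiddle 0ℓ) (ℝ : CompleteOrderedField) →
    let open Theory em ℝ in
    (σ : Signature) (G : Network σ) {n : ℕ} (φ : CPL σ n) → Safe G φ →
    ∃ λ (ψ : CPL σ n) → QuantifierFree ψ × AlmostSurelyEquivalent G φ ψ
theorem8p6 em ℝ σ G φ safe =
  let open Probability em ℝ
      ψ , qf , null = safe⇒almostSurelyQF G φ safe
  in ψ , qf , negligible⇒almostSurelyEquivalent G φ ψ null
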